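{- Let $V$ be an $n$-element set, $n\geq 3$. Then: (i) The Boolean sublattices of $\mathrm{Part}(V)$ of largest size are $(n-1)$-dimensional. (ii) The Boolean sublattices of $\mathrm{Part}(V)$ of dimension $n-1$ correspond bijectively to the trees with node set $V$, where the lattice corresponding to a tree $T$ consists of all partitions of $V$ each of whose blocks is a connected node set of $T$ (i.e. the vertex set of a subtree of $T$).
   Context: $\mathrm{Part}(V)$ is the lattice of all partitions of $V$ ordered by refinement ($\pi_1\le\pi_2$ iff every block of $\pi_2$ is a union of blocks of $\pi_1$). A Boolean sublattice is a sublattice (closed under meet and join of $\mathrm{Part}(V)$) that is itself a Boolean lattice. The dimension of a finite Boolean lattice is its number of atoms (equal to its height). -}

module Defs where

open import Level using (0ℓ) renaming (suc to lsuc)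
open import Data.Nat.Base using (ℕ; _≤_)
open import Data.Fin.Base using (Fin)
open import Data.Fin.Subset using (Subset; _∈_; _∩_; ⋃; ⊤; Nonempty; Empty)
open import Data.List.Base using (List; []; _∷_; _++_; length)
open import Data.List.Membership.Propositional using () renaming (_∈_ to _∈ˡ_)
open import Data.List.Relation.Binary.BagAndSetEquality using ([_]-Equality; set)
open import Data.List.Relation.Binary.Subset.Propositional using (_⊆_)
open import Data.List.Relation.Unary.All using (All)
open import Data.List.Relation.Unary.AllPairs using (AllPairs)
open import Data.List.Relation.Unary.Linked using (Linked)
open import Data.List.Relation.Unary.Unique.Propositional using (Unique)
import Data.List.Membership.Setoid as SetoidMembership
import Data.List.Relation.Unary.Unique.Setoid as SetoidUnique
open import Data.Product.Base using (Σ; ∃; ∃-syntax; _×_; proj₁)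
open import Function.Bundles using (_⇔_; Equivalence)
open import Function.Construct.Identity using (⇔-id)
open import Function.Construct.Symmetry using (⇔-sym)
open import Function.Construct.Composition using (_⇔-∘_)
open import Relation.Binary.Bundles using (Setoid)
open import Relation.Binary.Core using (Rel)
open import Relation.Binary.Definitions using (Symmetric; Irreflexive; Decidable)
import Relation.Binary.Construct.On as On
open import Relation.Binary.Construct.Closure.ReflexiveTransitive using (Star)
open import Relation.Binary.Lattice.Structures using (IsBooleanAlgebra)
open import Relation.Binary.PropositionalEquality.Core using (_≡_)
open import Relation.Nullary.Negation.Core using (¬_)
open import Relation.Unary using (Pred; _≐_)
open import Relation.Unary.Relation.Binary.Equality using (≐-setoid)

private
  variable
    n : ℕ

-- The n-element set V is Fin n.

record Partition (n : ℕ) : Set where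
  field
    blocks   : List (Subset n)
    nonempty : All Nonempty blocks
    disjoint : AllPairs (λ B C → Empty (B ∩ C)) blocks
    cover    : ⋃ blocks ≡ ⊤

open Partition public

-- The order in which the blocks are listed is immaterial.
partitionSetoid : ℕ → Setoid 0ℓ 0ℓ
partitionSetoid n = On.setoid ([ set ]-Equality (Subset n)) (blocks {n})

infix 4 _≈ₚ_ _≤ₚ_

_≈ₚ_ : Rel (Partition n) 0ℓ
_≈ₚ_ {n} = Setoid._≈_ (partitionSetoid n)

-- π ≤ₚ σ : every block of σ is a union of blocks of π.
_≤ₚ_ : Rel (Partition n) 0ℓ
π ≤ₚ σ = ∀ {B} → B ∈ˡ blocks σ → ∃[ Cs ] (Cs ⊆ blocks π × B ≡ ⋃ Cs)

IsMeet : Partition n → Partition n → Partition n → Set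
IsMeet π σ μ = μ ≤ₚ π × μ ≤ₚ σ × (∀ τ → τ ≤ₚ π → τ ≤ₚ σ → τ ≤ₚ μ)

IsJoin : Partition n → Partition n → Partition n → Set
IsJoin π σ μ = π ≤ₚ μ × σ ≤ₚ μ × (∀ τ → π ≤ₚ τ → σ ≤ₚ τ → μ ≤ₚ τ)

-- Complements and bounds are taken in L itself, not in Part(V).
IsBooleanLattice : Pred (Partition n) 0ℓ → Set
IsBooleanLattice {n} L =
  ∃[ join ] ∃[ meet ] ∃[ compl ] ∃[ top ] ∃[ bot ]
    IsBooleanAlgebra {A = Σ (Partition n) L}
      (λ x y → proj₁ x ≈ₚ proj₁ y) (λ x y → proj₁ x ≤ₚ proj₁ y)
      join meet compl top bot

-- A sublattice need not contain the least or the greatest partition.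
-- Meets and joins in the closure conditions are those of the whole of Part(V).
record IsBooleanSublattice (L : Pred (Partition n) 0ℓ) : Set where
  field
    respects         : ∀ {π σ} → π ≈ₚ σ → L π → L σ
    meet-closed      : ∀ {π σ μ} → L π → L σ → IsMeet π σ μ → L μ
    join-closed      : ∀ {π σ μ} → L π → L σ → IsJoin π σ μ → L μ
    isBooleanLattice : IsBooleanLattice L

-- P has exactly k elements up to _≈ₚ_.
HasSize : Pred (Partition n) 0ℓ → ℕ → Set
HasSize {n} P k =
  ∃[ πs ] (SetoidUnique.Unique (partitionSetoid n) πs × length πs ≡ k ×
           (∀ π → P π ⇔ SetoidMembership._∈_ (partitionSetoid n) π πs))

IsLeast : Pred (Partition n) 0ℓ → Pred (Partition n) 0ℓ
IsLeast L π = L π × (∀ σ → L σ → π ≤ₚ σ)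

-- Minimal elements of L among those other than its least element.
IsAtom : Pred (Partition n) 0ℓ → Pred (Partition n) 0ℓ
IsAtom L α =
  L α × ¬ IsLeast L α × (∀ β → L β → β ≤ₚ α → ¬ IsLeast L β → β ≈ₚ α)

HasDimension : Pred (Partition n) 0ℓ → ℕ → Set
HasDimension L d = HasSize (IsAtom L) d

IsLargestBooleanSublattice : Pred (Partition n) 0ℓ → Set₁
IsLargestBooleanSublattice {n} L =
  IsBooleanSublattice L ×
  ∃[ k ] (HasSize L k ×
          (∀ (L′ : Pred (Partition n) 0ℓ) k′ →
             IsBooleanSublattice L′ → HasSize L′ k′ → k′ ≤ k))

record BooleanSublattice (n d : ℕ) : Set₁ where
  field
    members             : Pred (Partition n) 0ℓ
    isBooleanSublattice : IsBooleanSublattice members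
    hasDimension        : HasDimension members d

open BooleanSublattice public using (members)

booleanSublatticeSetoid : ℕ → ℕ → Setoid (lsuc 0ℓ) 0ℓ
booleanSublatticeSetoid n d =
  On.setoid (≐-setoid (Partition n) 0ℓ) (members {n} {d})

-- The walks must stay inside S: it is the induced subgraph that is connected.
IsConnectedSet : Rel (Fin n) 0ℓ → Subset n → Set
IsConnectedSet E S =
  Nonempty S ×
  (∀ {x y} → x ∈ S → y ∈ S → Star (λ u v → u ∈ S × v ∈ S × E u v) x y)

-- x ∷ xs lists the distinct vertices, at least three, of a cycle.
IsCycle : Rel (Fin n) 0ℓ → Fin n → List (Fin n) → Set
IsCycle E x xs =
  2 ≤ length xs × Unique (x ∷ xs) × Linked E (x ∷ xs ++ x ∷ [])

record Tree (n : ℕ) : Set₁ where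
  field
    Edge        : Rel (Fin n) 0ℓ
    edge?       : Decidable Edge
    symmetric   : Symmetric Edge
    irreflexive : Irreflexive _≡_ Edge
    connected   : IsConnectedSet Edge ⊤
    acyclic     : ∀ x xs → ¬ IsCycle Edge x xs

open Tree public using (Edge)

treeSetoid : ℕ → Setoid (lsuc 0ℓ) 0ℓ
treeSetoid n = record
  { Carrier       = Tree n
  ; _≈_           = λ T T′ → ∀ x y → Edge T x y ⇔ Edge T′ x y
  ; isEquivalence = record
    { refl  = λ x y → ⇔-id _
    ; sym   = λ p x y → ⇔-sym (p x y)
    ; trans = λ p q x y → q x y ⇔-∘ p x y
    }
  }

treeLattice : Tree n → Pred (Partition n) 0ℓ
treeLattice T π = All (IsConnectedSet (Edge T)) (blocks π)

{-# OPTIONS --safe #-}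

-- A partition is handled through its relation "x and y lie in the same block". Strictly coarsening
-- a partition lowers its number of blocks, so a Boolean sublattice with d atoms, which is the cube of
-- all joins of sets of atoms, has d < n. If d = n - 1, every maximal chain of the cube is a maximal
-- chain of Part(V); hence each atom merges a single pair of vertices, and every element is the
-- partition generated by the pairs below it. These n - 1 pairs form an independent family, which
-- means that they are the edges of a spanning tree. Conversely the edges of a tree are independent,
-- and the partitions generated by subsets of an independent family are closed under meets and joins.
-- The star shows that dimension n - 1, i.e. size 2^(n-1), is attained.

module Submission where

open import Defs
open import Level using (Level; 0ℓ)
open import Data.Bool.Base using (Bool; true; false)
import Data.Bool.Properties as Bool
open import Data.Empty using (⊥-elim)
open import Data.Fin.Base using (Fin; zero; suc)
import Data.Fin.Base as Fin
import Data.Fin.Induction as Fin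
import Data.Fin.Properties as Fin
open import Data.Fin.Subset
  using (Subset; _∈_; _∉_; _⊆_; _⊂_; _∩_; _∪_; _-_; ∁; ⋃; ⊤; ⊥; ⁅_⁆; ∣_∣; Nonempty; Empty)
open import Data.Fin.Subset.Induction using (⊂-wellFounded)
open import Data.Fin.Subset.Properties
open import Data.List.Base
  using (List; []; _∷_; _++_; map; filter; length; tabulate; allFin; cartesianProduct; deduplicate)
import Data.List.Base as List
open import Data.List.Membership.Propositional using (find; lose) renaming (_∈_ to _∈ˡ_)
open import Data.List.Membership.Propositional.Properties
  using ( ∈-filter⁺; ∈-filter⁻; ∈-map⁺; ∈-map⁻; ∈-allFin; ∈-cartesianProduct⁺; ∈-lookup
        ; ∈-deduplicate⁺; ∈-deduplicate⁻ )
import Data.List.Membership.Setoid as SetoidMembership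
import Data.List.Properties as List
open import Data.List.Relation.Unary.All using (All; []; _∷_)
import Data.List.Relation.Unary.All as All
import Data.List.Relation.Unary.All.Properties as All
open import Data.List.Relation.Unary.AllPairs using (AllPairs; []; _∷_)
open import Data.List.Relation.Unary.Any using (here; there)
import Data.List.Relation.Unary.Any as Any
import Data.List.Relation.Unary.Any.Properties as Any
open import Data.List.Relation.Unary.Linked using (Linked; [-]; _∷_)
open import Data.List.Relation.Unary.Unique.DecPropositional.Properties using (deduplicate-!)
open import Data.List.Relation.Unary.Unique.Propositional using (Unique)
import Data.List.Relation.Unary.Unique.Propositional.Properties as Unique
import Data.List.Relation.Unary.Unique.Setoid as SetoidUnique
import Data.List.Relation.Unary.Unique.Setoid.Properties as SetoidUnique
open import Data.Nat.Base using (ℕ; zero; suc; _+_; _∸_; _^_; _≤_; _<_; z≤n; s≤s)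
import Data.Nat.Induction as ℕ
import Data.Nat.Properties as ℕ
open import Data.Product.Base using (Σ; Σ-syntax; ∃-syntax; _×_; _,_; proj₁; proj₂)
open import Data.Sum.Base using (_⊎_; inj₁; inj₂)
open import Data.Vec.Base using ([]; _∷_; here; there)
import Data.Vec.Base as Vec
import Data.Vec.Properties as Vec
open import Function.Base using (_∘_; id; case_of_)
open import Function.Bundles using (_⇔_; mk⇔; Bijection; Equivalence; Inverse)
open import Function.Construct.Symmetry using (⇔-sym)
open import Induction.WellFounded using (Acc; acc)
open import Relation.Binary.Bundles using (Setoid)
import Relation.Binary.Construct.On as On
open import Relation.Binary.Construct.Closure.ReflexiveTransitive
  using (Star; ε; _◅_; _◅◅_; reverse; fold)
import Relation.Binary.Construct.Closure.ReflexiveTransitive as Star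
open import Relation.Binary.Core using (Rel; _⇒_)
open import Relation.Binary.Definitions
  using (Decidable; Reflexive; Symmetric; Transitive; Irreflexive; tri<; tri≈; tri>)
open import Relation.Binary.Lattice.Bundles using (BooleanAlgebra)
import Relation.Binary.Lattice.Properties.HeytingAlgebra as HeytingAlgebraProperties
open import Relation.Binary.PropositionalEquality
  using (_≡_; _≢_; refl; sym; trans; cong; cong₂; subst; subst₂; setoid; isEquivalence)
open import Relation.Binary.Structures using (IsEquivalence)
open import Relation.Nullary using (¬_; Dec; yes; no; does; contradiction)
open import Relation.Nullary.Decidable
  using (map′; _×-dec_; _⊎-dec_; _→-dec_; ¬?; decidable-stable; dec-true; dec-false)
import Relation.Nullary.Decidable as Dec
open import Relation.Unary using (Pred; _≐_)
import Relation.Unary as Unary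
open import Relation.Unary.Properties using (≐-sym; ≐-trans)

-- A cube is carried as an order embedding `J` of `Subset m`, because the counting sees only strict
-- steps. Its numerical core is the sum `blockCount (J S) + ∣ S ∣`: enlarging `S` never raises it,
-- so it lies between `1 + m`, forced at `⊤` by the one block that must remain, and `n`, forced at
-- `⊥`. For `m` equal to `n ∸ 1` the sum is constant, and a partition squeezed strictly into a gap
-- of a single step is refuted by comparing counts. In the converse direction the obstacle is
-- closure under the meets of Part(V): vertices connected by `S` and also by `T` need not be
-- connected by `S ∩ T` for a general family, and independence repairs this. A tree is recovered
-- from its lattice because, for distinct `x` and `y`, the partition whose only nontrivial block
-- consists of `x` and `y` belongs to the lattice exactly when `xy` is an edge.

private
  variable
    ℓ : Level
    m n : ℕ

-- Subsets from decidable predicates, unions of lists of subsets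

does-true⇒ : ∀ {A : Set ℓ} (A? : Dec A) → does A? ≡ true → A
does-true⇒ (yes a) _ = a

module _ {P : Pred (Fin n) ℓ} (P? : Unary.Decidable P) where

  subsetOf : Subset n
  subsetOf = Vec.tabulate (does ∘ P?)

  ∈-subsetOf⁺ : ∀ {x} → P x → x ∈ subsetOf
  ∈-subsetOf⁺ {x} px =
    Vec.lookup⇒[]= x _ (trans (Vec.lookup∘tabulate _ x) (dec-true (P? x) px))

  ∈-subsetOf⁻ : ∀ {x} → x ∈ subsetOf → P x
  ∈-subsetOf⁻ {x} x∈ =
    does-true⇒ (P? x) (trans (sym (Vec.lookup∘tabulate _ x)) (Vec.[]=⇒lookup x∈))

∈-⋃⁺ : ∀ {x : Fin n} {B Bs} → B ∈ˡ Bs → x ∈ B → x ∈ ⋃ Bs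
∈-⋃⁺ (here refl) x∈B = x∈p∪q⁺ (inj₁ x∈B)
∈-⋃⁺ (there B∈Bs) x∈B = x∈p∪q⁺ (inj₂ (∈-⋃⁺ B∈Bs x∈B))

∈-⋃⁻ : ∀ {x : Fin n} Bs → x ∈ ⋃ Bs → ∃[ B ] B ∈ˡ Bs × x ∈ B
∈-⋃⁻ [] x∈ = contradiction x∈ ∉⊥
∈-⋃⁻ (B ∷ Bs) x∈ with x∈p∪q⁻ B (⋃ Bs) x∈
... | inj₁ x∈B = B , here refl , x∈B
... | inj₂ x∈⋃ with C , C∈ , x∈C ← ∈-⋃⁻ Bs x∈⋃ = C , there C∈ , x∈C

-- Partitions as equivalence relations

infix 4 SameBlock
SameBlock : Partition n → Rel (Fin n) 0ℓ
SameBlock π x y = ∃[ B ] B ∈ˡ blocks π × x ∈ B × y ∈ B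

syntax SameBlock π x y = x ∼[ π ] y

blockOf : ∀ (π : Partition n) x → ∃[ B ] B ∈ˡ blocks π × x ∈ B
blockOf π x = ∈-⋃⁻ (blocks π) (subst (x ∈_) (sym (cover π)) ∈⊤)

AllPairs-disjoint⇒≡ : ∀ {Bs : List (Subset n)} → AllPairs (λ B C → Empty (B ∩ C)) Bs →
  ∀ {B C x} → B ∈ˡ Bs → C ∈ˡ Bs → x ∈ B → x ∈ C → B ≡ C
AllPairs-disjoint⇒≡ _ (here refl) (here refl) _ _ = refl
AllPairs-disjoint⇒≡ (B# ∷ _) (here refl) (there C∈) x∈B x∈C =
  contradiction (_ , x∈p∩q⁺ (x∈B , x∈C)) (All.lookup B# C∈)
AllPairs-disjoint⇒≡ (C# ∷ _) (there B∈) (here refl) x∈B x∈C =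
  contradiction (_ , x∈p∩q⁺ (x∈C , x∈B)) (All.lookup C# B∈)
AllPairs-disjoint⇒≡ (_ ∷ Bs#) (there B∈) (there C∈) x∈B x∈C =
  AllPairs-disjoint⇒≡ Bs# B∈ C∈ x∈B x∈C

block-unique : ∀ (π : Partition n) {B C x} →
  B ∈ˡ blocks π → C ∈ˡ blocks π → x ∈ B → x ∈ C → B ≡ C
block-unique π = AllPairs-disjoint⇒≡ (disjoint π)

∼-refl : ∀ (π : Partition n) → Reflexive (SameBlock π)
∼-refl π {x} with B , B∈ , x∈B ← blockOf π x = B , B∈ , x∈B , x∈B

∼-sym : ∀ (π : Partition n) → Symmetric (SameBlock π)
∼-sym π (B , B∈ , x∈B , y∈B) = B , B∈ , y∈B , x∈B

∼-trans : ∀ (π : Partition n) → Transitive (SameBlock π)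
∼-trans π (B , B∈ , x∈B , y∈B) (C , C∈ , y∈C , z∈C)
  with refl ← block-unique π B∈ C∈ y∈B y∈C = B , B∈ , x∈B , z∈C

∼-isEquivalence : ∀ (π : Partition n) → IsEquivalence (SameBlock π)
∼-isEquivalence π = record { refl = ∼-refl π ; sym = ∼-sym π ; trans = ∼-trans π }

∼? : ∀ (π : Partition n) → Decidable (SameBlock π)
∼? π x y = map′ find (λ (B , B∈ , xy∈B) → lose B∈ xy∈B)
  (Any.any? (λ B → (x ∈? B) ×-dec (y ∈? B)) (blocks π))

∼⇒∈ : ∀ (π : Partition n) {B x y} → B ∈ˡ blocks π → x ∈ B → x ∼[ π ] y → y ∈ B
∼⇒∈ π B∈ x∈B (C , C∈ , x∈C , y∈C) with refl ← block-unique π B∈ C∈ x∈B x∈C = y∈C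

≤⇒∼ : ∀ {π σ : Partition n} → π ≤ₚ σ → SameBlock π ⇒ SameBlock σ
≤⇒∼ {π = π} {σ} π≤σ {x} (B , B∈ , x∈B , y∈B)
  with C , C∈ , x∈C ← blockOf σ x
  with Cs , Cs⊆ , refl ← π≤σ C∈
  with D , D∈ , x∈D ← ∈-⋃⁻ Cs x∈C
  with refl ← block-unique π B∈ (Cs⊆ D∈) x∈B x∈D
  = C , C∈ , x∈C , ∈-⋃⁺ D∈ y∈B

∼⇒≤ : ∀ {π σ : Partition n} → SameBlock π ⇒ SameBlock σ → π ≤ₚ σ
∼⇒≤ {π = π} {σ} ∼⇒∼ {C} C∈ =
  Cs , proj₁ ∘ ∈-filter⁻ (_⊆? C) , ⊆-antisym C⊆⋃ ⋃⊆C
  where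
  Cs = filter (_⊆? C) (blocks π)
  C⊆⋃ : C ⊆ ⋃ Cs
  C⊆⋃ {x} x∈C with B , B∈ , x∈B ← blockOf π x =
    ∈-⋃⁺ (∈-filter⁺ (_⊆? C) B∈ λ y∈B → ∼⇒∈ σ C∈ x∈C (∼⇒∼ (B , B∈ , x∈B , y∈B))) x∈B
  ⋃⊆C : ⋃ Cs ⊆ C
  ⋃⊆C x∈ with B , B∈ , x∈B ← ∈-⋃⁻ Cs x∈ = proj₂ (∈-filter⁻ (_⊆? C) {xs = blocks π} B∈) x∈B

≤ₚ-refl : ∀ {π : Partition n} → π ≤ₚ π
≤ₚ-refl {π = π} = ∼⇒≤ {π = π} {π} id

≤ₚ-trans : ∀ {π σ τ : Partition n} → π ≤ₚ σ → σ ≤ₚ τ → π ≤ₚ τ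
≤ₚ-trans {π = π} {σ} {τ} π≤σ σ≤τ =
  ∼⇒≤ {π = π} {τ} (≤⇒∼ {π = σ} {τ} σ≤τ ∘ ≤⇒∼ {π = π} {σ} π≤σ)

≤ₚ? : Decidable (_≤ₚ_ {n})
≤ₚ? π σ = map′ (λ h → ∼⇒≤ {π = π} {σ} (h _ _)) (λ h _ _ → ≤⇒∼ {π = π} {σ} h)
  (Fin.all? λ x → Fin.all? λ y → ∼? π x y →-dec ∼? σ x y)

≈⇒≤ : ∀ {π σ : Partition n} → π ≈ₚ σ → π ≤ₚ σ
≈⇒≤ {π = π} {σ} π≈σ = ∼⇒≤ {π = π} {σ} λ (B , B∈ , xy∈B) → B , Equivalence.to π≈σ B∈ , xy∈B

≈⇒≥ : ∀ {π σ : Partition n} → π ≈ₚ σ → σ ≤ₚ π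
≈⇒≥ {n} {π} {σ} π≈σ = ≈⇒≤ {π = σ} {π} (Setoid.sym (partitionSetoid n) {π} {σ} π≈σ)

≤ₚ-antisym : ∀ {π σ : Partition n} → π ≤ₚ σ → σ ≤ₚ π → π ≈ₚ σ
≤ₚ-antisym {π = π} {σ} π≤σ σ≤π = mk⇔ (blocks⊆ π σ π≤σ σ≤π) (blocks⊆ σ π σ≤π π≤σ)
  where
  blocks⊆ : ∀ (π σ : Partition _) → π ≤ₚ σ → σ ≤ₚ π → ∀ {B} → B ∈ˡ blocks π → B ∈ˡ blocks σ
  blocks⊆ π σ π≤σ σ≤π {B} B∈
    with x , x∈B ← All.lookup (nonempty π) B∈
    with C , C∈ , x∈C ← blockOf σ x
    = subst (_∈ˡ blocks σ) (⊆-antisym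
        (λ y∈C → ∼⇒∈ π B∈ x∈B (≤⇒∼ {π = σ} {π} σ≤π (C , C∈ , x∈C , y∈C)))
        (λ y∈B → ∼⇒∈ σ C∈ x∈C (≤⇒∼ {π = π} {σ} π≤σ (B , B∈ , x∈B , y∈B)))) C∈

≈ₚ? : Decidable (_≈ₚ_ {n})
≈ₚ? π σ with ≤ₚ? π σ | ≤ₚ? σ π
... | yes π≤σ | yes σ≤π = yes (≤ₚ-antisym {π = π} {σ} π≤σ σ≤π)
... | no π≰σ | _ = no λ π≈σ → π≰σ (≈⇒≤ {π = π} {σ} π≈σ)
... | yes _ | no σ≰π = no λ π≈σ → σ≰π (≈⇒≥ {π = π} {σ} π≈σ)

-- Partitions from equivalence relations, merging of two blocks

module _ {R : Rel (Fin n) 0ℓ} (isEq : IsEquivalence R) (R? : Decidable R) where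
  private
    module R = IsEquivalence isEq

    class : Fin n → Subset n
    class x = subsetOf (R? x)

    _≟ˢ_ = Vec.≡-dec {n = n} Bool._≟_

    classes : List (Subset n)
    classes = map class (allFin n)

    class-∈ : ∀ x → class x ∈ˡ deduplicate _≟ˢ_ classes
    class-∈ x = ∈-deduplicate⁺ _≟ˢ_ (∈-map⁺ class (∈-allFin x))

    IsClass : Subset n → Set
    IsClass B = ∃[ x ] B ≡ class x

    allClasses : All IsClass (deduplicate _≟ˢ_ classes)
    allClasses = All.tabulate λ B∈ →
      let x , _ , eq = ∈-map⁻ class (∈-deduplicate⁻ _≟ˢ_ classes B∈) in x , eq

    class-⊆ : ∀ {x y} → R x y → class y ⊆ class x
    class-⊆ xRy z∈ = ∈-subsetOf⁺ (R? _) (R.trans xRy (∈-subsetOf⁻ (R? _) z∈))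

    meeting⇒≡ : ∀ {B C} → IsClass B → IsClass C → Nonempty (B ∩ C) → B ≡ C
    meeting⇒≡ (x , refl) (y , refl) (z , z∈) with x∈p∩q⁻ (class x) (class y) z∈
    ... | z∈x , z∈y = ⊆-antisym (class-⊆ (R.sym xRy)) (class-⊆ xRy)
      where xRy = R.trans (∈-subsetOf⁻ (R? x) z∈x) (R.sym (∈-subsetOf⁻ (R? y) z∈y))

    unique⇒disjoint : ∀ {Bs} → All IsClass Bs → Unique Bs → AllPairs (λ B C → Empty (B ∩ C)) Bs
    unique⇒disjoint [] [] = []
    unique⇒disjoint (B-class ∷ Bs-class) (B∉ ∷ Bs!) =
      All.zipWith (λ (C-class , B≢C) → B≢C ∘ meeting⇒≡ B-class C-class) (Bs-class , B∉)
      ∷ unique⇒disjoint Bs-class Bs!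

  -- Every point contributes its class, so a class is listed once for each of its points; `disjoint`
  -- forbids a repeated nonempty block, hence the deduplication.
  fromEquivalence : Partition n
  fromEquivalence = record
    { blocks   = deduplicate _≟ˢ_ classes
    ; nonempty = All.map (λ { (x , refl) → x , ∈-subsetOf⁺ (R? x) R.refl }) allClasses
    ; disjoint = unique⇒disjoint allClasses (deduplicate-! _≟ˢ_ classes)
    ; cover    = ⊆-antisym (⊆-max _) λ {x} _ → ∈-⋃⁺ (class-∈ x) (∈-subsetOf⁺ (R? x) R.refl)
    }

  fromEquivalence⁺ : R ⇒ SameBlock fromEquivalence
  fromEquivalence⁺ {x} xRy =
    class x , class-∈ x , ∈-subsetOf⁺ (R? x) R.refl , ∈-subsetOf⁺ (R? x) xRy

  fromEquivalence⁻ : SameBlock fromEquivalence ⇒ R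
  fromEquivalence⁻ (B , B∈ , y∈B , z∈B) with x , refl ← All.lookup allClasses B∈ =
    R.trans (R.sym (∈-subsetOf⁻ (R? x) y∈B)) (∈-subsetOf⁻ (R? x) z∈B)

discrete : Partition n
discrete = fromEquivalence isEquivalence Fin._≟_

discrete⁻ : ∀ {x y : Fin n} → x ∼[ discrete ] y → x ≡ y
discrete⁻ = fromEquivalence⁻ isEquivalence Fin._≟_

-- Already transitive: a chain that crosses between the blocks of `a` and `b` twice is back where it
-- began. So the join of `π` with the pair needs no transitive closure and inherits decidability
-- from `∼?`.
Merged : Partition n → Fin n → Fin n → Rel (Fin n) 0ℓ
Merged π a b x y =
  x ∼[ π ] y ⊎ (x ∼[ π ] a × b ∼[ π ] y) ⊎ (x ∼[ π ] b × a ∼[ π ] y)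

module _ (π : Partition n) (a b : Fin n) where
  private
    Merged-isEquivalence : IsEquivalence (Merged π a b)
    Merged-isEquivalence = record { refl = inj₁ (∼-refl π) ; sym = symm ; trans = transi }
      where
      s : Symmetric (SameBlock π)
      s = ∼-sym π
      infixr 5 _∙_
      _∙_ : Transitive (SameBlock π)
      _∙_ = ∼-trans π
      symm : Symmetric (Merged π a b)
      symm (inj₁ xy) = inj₁ (s xy)
      symm (inj₂ (inj₁ (xa , by))) = inj₂ (inj₂ (s by , s xa))
      symm (inj₂ (inj₂ (xb , ay))) = inj₂ (inj₁ (s ay , s xb))
      transi : Transitive (Merged π a b)
      transi (inj₁ xy) (inj₁ yz) = inj₁ (xy ∙ yz)
      transi (inj₁ xy) (inj₂ (inj₁ (ya , bz))) = inj₂ (inj₁ (xy ∙ ya , bz))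
      transi (inj₁ xy) (inj₂ (inj₂ (yb , az))) = inj₂ (inj₂ (xy ∙ yb , az))
      transi (inj₂ (inj₁ (xa , by))) (inj₁ yz) = inj₂ (inj₁ (xa , by ∙ yz))
      transi (inj₂ (inj₁ (xa , by))) (inj₂ (inj₁ (ya , bz))) = inj₁ (xa ∙ s ya ∙ s by ∙ bz)
      transi (inj₂ (inj₁ (xa , by))) (inj₂ (inj₂ (yb , az))) = inj₁ (xa ∙ az)
      transi (inj₂ (inj₂ (xb , ay))) (inj₁ yz) = inj₂ (inj₂ (xb , ay ∙ yz))
      transi (inj₂ (inj₂ (xb , ay))) (inj₂ (inj₁ (ya , bz))) = inj₁ (xb ∙ bz)
      transi (inj₂ (inj₂ (xb , ay))) (inj₂ (inj₂ (yb , az))) = inj₁ (xb ∙ s yb ∙ s ay ∙ az)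

    Merged? : Decidable (Merged π a b)
    Merged? x y = ∼? π x y ⊎-dec ((∼? π x a ×-dec ∼? π b y) ⊎-dec (∼? π x b ×-dec ∼? π a y))

  merge : Partition n
  merge = fromEquivalence Merged-isEquivalence Merged?

  merge⁺ : Merged π a b ⇒ SameBlock merge
  merge⁺ = fromEquivalence⁺ Merged-isEquivalence Merged?

  merge⁻ : SameBlock merge ⇒ Merged π a b
  merge⁻ = fromEquivalence⁻ Merged-isEquivalence Merged?

  merge-joins : a ∼[ merge ] b
  merge-joins = merge⁺ (inj₂ (inj₁ (∼-refl π , ∼-refl π)))

  merge-least : ∀ {Q : Rel (Fin n) 0ℓ} → IsEquivalence Q → SameBlock π ⇒ Q → Q a b →
    SameBlock merge ⇒ Q
  merge-least isEq π⇒Q ab {x} {y} xy = case merge⁻ xy of λ where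
      (inj₁ xy) → π⇒Q xy
      (inj₂ (inj₁ (xa , by))) → Q.trans (π⇒Q xa) (Q.trans ab (π⇒Q by))
      (inj₂ (inj₂ (xb , ay))) → Q.trans (π⇒Q xb) (Q.trans (Q.sym ab) (π⇒Q ay))
    where module Q = IsEquivalence isEq

-- The vertex set is finite and `SameBlock` is decidable, so a violating pair is found by search.
-- The edges of the tree of a maximal cube originate here.
≰⇒∃ : ∀ (π σ : Partition n) → ¬ σ ≤ₚ π → ∃[ x ] ∃[ y ] x ∼[ σ ] y × ¬ x ∼[ π ] y
≰⇒∃ π σ σ≰π with Fin.any? (λ x → Fin.any? λ y → ∼? σ x y ×-dec ¬? (∼? π x y))
... | yes ∃xy = ∃xy
... | no ∄xy = ⊥-elim (σ≰π
  (∼⇒≤ {π = σ} {π} λ {x} {y} x∼y → decidable-stable (∼? π x y) λ x≁y → ∄xy (x , y , x∼y , x≁y)))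

∣p∣≤1+∣p-x∣ : ∀ (p : Subset n) x → ∣ p ∣ ≤ suc ∣ p - x ∣
∣p∣≤1+∣p-x∣ (true ∷ p) zero = s≤s (ℕ.≤-reflexive (cong ∣_∣ (sym (p─⊥≡p p))))
∣p∣≤1+∣p-x∣ (false ∷ p) zero = ℕ.m≤n⇒m≤1+n (ℕ.≤-reflexive (cong ∣_∣ (sym (p─⊥≡p p))))
∣p∣≤1+∣p-x∣ (true ∷ p) (suc x) = s≤s (∣p∣≤1+∣p-x∣ p x)
∣p∣≤1+∣p-x∣ (false ∷ p) (suc x) = ∣p∣≤1+∣p-x∣ p x

x∉p-x : ∀ (p : Subset n) x → x ∉ p - x
x∉p-x (true ∷ p) (suc x) = x∉p-x p x ∘ drop-there
x∉p-x (false ∷ p) (suc x) = x∉p-x p x ∘ drop-there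
x∉p-x (true ∷ p) zero ()
x∉p-x (false ∷ p) zero ()

x∈p⇒⁅x⁆⊆p : ∀ {p : Subset n} {x} → x ∈ p → ⁅ x ⁆ ⊆ p
x∈p⇒⁅x⁆⊆p {p = p} {x} x∈p y∈ = subst (_∈ p) (sym (x∈⁅y⁆⇒x≡y x y∈)) x∈p

-- The number of blocks, each being counted through its least element.

IsLeader : Partition n → Fin n → Set
IsLeader π x = ¬ (∃[ y ] (y Fin.< x × y ∼[ π ] x))

isLeader? : ∀ (π : Partition n) x → Dec (IsLeader π x)
isLeader? π x = ¬? (Fin.any? λ y → (y Fin.<? x) ×-dec ∼? π y x)

leaders : Partition n → Subset n
leaders π = subsetOf (isLeader? π)

blockCount : Partition n → ℕ
blockCount π = ∣ leaders π ∣

leaderOf : ∀ (π : Partition n) x → ∃[ u ] IsLeader π u × u ∼[ π ] x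
leaderOf π x = go x (Fin.<-wellFounded x)
  where
  go : ∀ x → Acc Fin._<_ x → ∃[ u ] IsLeader π u × u ∼[ π ] x
  go x (acc rs) with Fin.any? (λ y → (y Fin.<? x) ×-dec ∼? π y x)
  ... | no leader = x , leader , ∼-refl π
  ... | yes (y , y<x , y∼x) with u , leader , u∼y ← go y (rs y<x) = u , leader , ∼-trans π u∼y y∼x

leader-unique : ∀ (π : Partition n) {u v} → IsLeader π u → IsLeader π v → u ∼[ π ] v → u ≡ v
leader-unique π {u} {v} u-leader v-leader u∼v with Fin.<-cmp u v
... | tri< u<v _ _ = contradiction (u , u<v , u∼v) v-leader
... | tri≈ _ u≡v _ = u≡v
... | tri> _ _ v<u = contradiction (v , v<u , ∼-sym π u∼v) u-leader

-- A leader of the coarser `σ` has no smaller companion in the finer `π` either, so leaders only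
-- disappear. A pair joined by `σ` alone exhibits two leaders of `π` in one block of `σ`, and the
-- larger of them is lost.
blockCount-strict : ∀ (π σ : Partition n) → π ≤ₚ σ → ¬ σ ≤ₚ π → blockCount σ < blockCount π
blockCount-strict π σ π≤σ σ≰π
  with x , y , x∼y , x≁y ← ≰⇒∃ π σ σ≰π
  with u , u-leader , u∼x ← leaderOf π x
  with v , v-leader , v∼y ← leaderOf π y
  = p⊂q⇒∣p∣<∣q∣ (leaders⊆ , extra)
  where
  π⇒σ : SameBlock π ⇒ SameBlock σ
  π⇒σ = ≤⇒∼ {π = π} {σ} π≤σ
  u∼v : u ∼[ σ ] v
  u∼v = ∼-trans σ (π⇒σ u∼x) (∼-trans σ x∼y (∼-sym σ (π⇒σ v∼y)))
  leaders⊆ : leaders σ ⊆ leaders π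
  leaders⊆ w∈ = ∈-subsetOf⁺ (isLeader? π) λ (z , z<w , z∼w) →
    ∈-subsetOf⁻ (isLeader? σ) w∈ (z , z<w , π⇒σ z∼w)
  extra : ∃[ w ] w ∈ leaders π × w ∉ leaders σ
  extra with Fin.<-cmp u v
  ... | tri< u<v _ _ = v , ∈-subsetOf⁺ (isLeader? π) v-leader ,
    λ v∈ → ∈-subsetOf⁻ (isLeader? σ) v∈ (u , u<v , u∼v)
  ... | tri≈ _ refl _ = contradiction (∼-trans π (∼-sym π u∼x) v∼y) x≁y
  ... | tri> _ _ v<u = u , ∈-subsetOf⁺ (isLeader? π) u-leader ,
    λ u∈ → ∈-subsetOf⁻ (isLeader? σ) u∈ (v , v<u , ∼-sym σ u∼v)

blockCount≤n : ∀ (π : Partition n) → blockCount π ≤ n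
blockCount≤n π = ∣p∣≤n (leaders π)

⁅leader⁆⊆leaders : ∀ (π : Partition n) {u} → IsLeader π u → ⁅ u ⁆ ⊆ leaders π
⁅leader⁆⊆leaders π u-leader = x∈p⇒⁅x⁆⊆p (∈-subsetOf⁺ (isLeader? π) u-leader)

1≤blockCount : ∀ (π : Partition n) → Fin n → 1 ≤ blockCount π
1≤blockCount π x with u , u-leader , _ ← leaderOf π x =
  subst (_≤ blockCount π) (∣⁅x⁆∣≡1 u) (p⊆q⇒∣p∣≤∣q∣ (⁅leader⁆⊆leaders π u-leader))

blockCount≤1⇒∼ : ∀ (π : Partition n) → blockCount π ≤ 1 → ∀ x y → x ∼[ π ] y
blockCount≤1⇒∼ π ≤1 x y
  with u , u-leader , u∼x ← leaderOf π x
  with v , v-leader , v∼y ← leaderOf π y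
  with u Fin.≟ v
... | yes refl = ∼-trans π (∼-sym π u∼x) v∼y
... | no u≢v = contradiction
  (p⊂q⇒∣p∣<∣q∣ {p = ⁅ u ⁆}
    ( ⁅leader⁆⊆leaders π u-leader
    , v , ∈-subsetOf⁺ (isLeader? π) v-leader , x≢y⇒x∉⁅y⁆ (u≢v ∘ sym)))
  (ℕ.≤⇒≯ (subst (blockCount π ≤_) (sym (∣⁅x⁆∣≡1 u)) ≤1))

∼⇒blockCount≤1 : ∀ (π : Partition n) x → (∀ y → x ∼[ π ] y) → blockCount π ≤ 1
∼⇒blockCount≤1 π x x∼ with u , u-leader , u∼x ← leaderOf π x =
  subst (blockCount π ≤_) (∣⁅x⁆∣≡1 u) (p⊆q⇒∣p∣≤∣q∣ λ {w} w∈ →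
    subst (_∈ ⁅ u ⁆)
      (leader-unique π u-leader (∈-subsetOf⁻ (isLeader? π) w∈) (∼-trans π u∼x (x∼ w)))
      (x∈⁅x⁆ u))

n≤blockCount-discrete : n ≤ blockCount (discrete {n})
n≤blockCount-discrete {n} = subst (_≤ blockCount (discrete {n})) (∣⊤∣≡n n)
  (p⊆q⇒∣p∣≤∣q∣ {p = ⊤} {leaders (discrete {n})} λ _ → ∈-subsetOf⁺ (isLeader? (discrete {n})) λ (y , y<x , y∼x) →
    Fin.<-irrefl (discrete⁻ y∼x) y<x)

-- Of the leaders `u` of `a` and `v` of `b` only the larger can lose its role: other blocks keep
-- their least elements, and the merged block keeps the smaller of the two.
blockCount-merge : ∀ (π : Partition n) a b → blockCount π ≤ suc (blockCount (merge π a b))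
blockCount-merge π a b
  with u , u-leader , u∼a ← leaderOf π a
  with v , v-leader , v∼b ← leaderOf π b
  = case Fin.<-cmp u v of λ where
      (tri< u<v _ _) → drop v λ (x-leader , x≢v) (y , y<x , y∼x) → case merge⁻ π a b y∼x of λ where
        (inj₁ y∼x) → x-leader (y , y<x , y∼x)
        (inj₂ (inj₁ (_ , b∼x))) → x≢v (leader-unique π x-leader v-leader (s (v∼b ∙ b∼x)))
        (inj₂ (inj₂ (y∼b , a∼x))) → case leader-unique π u-leader x-leader (u∼a ∙ a∼x) of λ where
          refl → v-leader (y , Fin.<-trans y<x u<v , y∼b ∙ s v∼b)
      -- Here `a` and `b` already share a block and every leader survives; dropping `v` merely fits
      -- the common bound.
      (tri≈ _ refl _) → drop v λ (x-leader , _) (y , y<x , y∼x) → case merge⁻ π a b y∼x of λ where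
        (inj₁ y∼x) → x-leader (y , y<x , y∼x)
        (inj₂ (inj₁ (y∼a , b∼x))) → x-leader (y , y<x , y∼a ∙ s u∼a ∙ v∼b ∙ b∼x)
        (inj₂ (inj₂ (y∼b , a∼x))) → x-leader (y , y<x , y∼b ∙ s v∼b ∙ u∼a ∙ a∼x)
      (tri> _ _ v<u) → drop u λ (x-leader , x≢u) (y , y<x , y∼x) → case merge⁻ π a b y∼x of λ where
        (inj₁ y∼x) → x-leader (y , y<x , y∼x)
        (inj₂ (inj₁ (y∼a , b∼x))) → case leader-unique π v-leader x-leader (v∼b ∙ b∼x) of λ where
          refl → u-leader (y , Fin.<-trans y<x v<u , y∼a ∙ s u∼a)
        (inj₂ (inj₂ (_ , a∼x))) → x≢u (leader-unique π x-leader u-leader (s (u∼a ∙ a∼x)))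
  where
  infixr 5 _∙_
  _∙_ : ∀ {x y z} → x ∼[ π ] y → y ∼[ π ] z → x ∼[ π ] z
  _∙_ = ∼-trans π
  s : ∀ {x y} → x ∼[ π ] y → y ∼[ π ] x
  s = ∼-sym π
  drop : ∀ w → (∀ {x} → IsLeader π x × x ≢ w → IsLeader (merge π a b) x) →
    blockCount π ≤ suc (blockCount (merge π a b))
  drop w leader = ℕ.≤-trans (∣p∣≤1+∣p-x∣ (leaders π) w) (s≤s (p⊆q⇒∣p∣≤∣q∣ λ {x} x∈ →
    ∈-subsetOf⁺ (isLeader? (merge π a b)) (leader
      ( ∈-subsetOf⁻ (isLeader? π) (p─q⊆p (leaders π) ⁅ w ⁆ x∈)
      , λ { refl → x∉p-x (leaders π) w x∈ }))))

-- Cubes of partitions: block-count bounds, Boolean structure, size and atoms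

record IsOrderEmbedding (J : Subset m → Partition n) : Set where
  field
    mono   : ∀ {S T} → S ⊆ T → J S ≤ₚ J T
    cancel : ∀ {S T} → J S ≤ₚ J T → S ⊆ T

Image : (Subset m → Partition n) → Pred (Partition n) 0ℓ
Image J π = ∃[ S ] π ≈ₚ J S

-- Binary numbering of the subsets: `decode` lists a cube as `2 ^ m` partitions, `encode` bounds the
-- size of a predicate contained in a cube.
decode : Fin (2 ^ m) → Subset m
decode k = Vec.tabulate (Inverse.to Fin.2↔Bool ∘ Fin.finToFun k)

encode : Subset m → Fin (2 ^ m)
encode S = Fin.funToFin (Inverse.from Fin.2↔Bool ∘ Vec.lookup S)

decode-encode : ∀ (S : Subset m) → decode (encode S) ≡ S
decode-encode S = trans
  (Vec.tabulate-cong λ i → trans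
    (cong (Inverse.to Fin.2↔Bool) (Fin.finToFun-funToFin (Inverse.from Fin.2↔Bool ∘ Vec.lookup S) i))
    (Inverse.strictlyInverseˡ Fin.2↔Bool (Vec.lookup S i)))
  (Vec.tabulate∘lookup S)

-- Stands in for function extensionality: the digits recovered in `encode-decode` agree with the
-- original ones only pointwise.
funToFin-cong : ∀ m {k} {f g : Fin m → Fin k} → (∀ i → f i ≡ g i) → Fin.funToFin f ≡ Fin.funToFin g
funToFin-cong zero _ = refl
funToFin-cong (suc m) f≗g = cong₂ Fin.combine (f≗g zero) (funToFin-cong m (f≗g ∘ suc))

encode-decode : ∀ m (k : Fin (2 ^ m)) → encode {m} (decode {m} k) ≡ k
encode-decode m k = trans
  (funToFin-cong m {2} {g = Fin.finToFun k} λ i → trans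
    (cong (Inverse.from Fin.2↔Bool)
      (Vec.lookup∘tabulate (Inverse.to Fin.2↔Bool ∘ Fin.finToFun {m = 2} {m} k) i))
    (Inverse.strictlyInverseʳ Fin.2↔Bool (Fin.finToFun k i)))
  (Fin.funToFin-finToFin {m} {2} k)

encode-injective : ∀ {S T : Subset m} → encode S ≡ encode T → S ≡ T
encode-injective {S = S} {T} eq = trans (sym (decode-encode S)) (trans (cong decode eq) (decode-encode T))

decode-injective : ∀ m {k l : Fin (2 ^ m)} → decode {m} k ≡ decode {m} l → k ≡ l
decode-injective m {k} {l} eq =
  trans (sym (encode-decode m k)) (trans (cong (encode {m}) eq) (encode-decode m l))

infix 4 _∈ₚ_
_∈ₚ_ : Partition n → List (Partition n) → Set
_∈ₚ_ = SetoidMembership._∈_ (partitionSetoid _)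

module _ {k} (f : Fin k → Partition n) (π : Partition n) where

  ∈-tabulate⁺ : ∀ i → π ≈ₚ f i → π ∈ₚ tabulate f
  ∈-tabulate⁺ i π≈fi = Any.tabulate⁺ {P = λ σ → π ≈ₚ σ} {f = f} i π≈fi

  ∈-tabulate⁻ : π ∈ₚ tabulate f → ∃[ i ] π ≈ₚ f i
  ∈-tabulate⁻ = Any.tabulate⁻ {P = λ σ → π ≈ₚ σ} {f = f}

Image-resp : ∀ (J : Subset m → Partition n) π σ → π ≈ₚ σ → Image J π → Image J σ
Image-resp {n = n} J π σ π≈σ (S , π≈JS) = S , Setoid.trans (partitionSetoid n) {σ} {π} {J S}
  (Setoid.sym (partitionSetoid n) {π} {σ} π≈σ) π≈JS

module _ {L : Pred (Partition n) 0ℓ} (resp : ∀ π σ → π ≈ₚ σ → L π → L σ) where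

  IsLeast-resp : ∀ π σ → π ≈ₚ σ → IsLeast L π → IsLeast L σ
  IsLeast-resp π σ π≈σ (π∈L , least) = resp π σ π≈σ π∈L , λ τ τ∈L →
    ≤ₚ-trans {π = σ} {π} {τ} (≈⇒≥ {π = π} {σ} π≈σ) (least τ τ∈L)

  IsAtom-resp : ∀ π σ → π ≈ₚ σ → IsAtom L π → IsAtom L σ
  IsAtom-resp π σ π≈σ (π∈L , notLeast , minimal) =
    resp π σ π≈σ π∈L
    , (λ least → notLeast (IsLeast-resp σ π (Setoid.sym (partitionSetoid n) {π} {σ} π≈σ) least))
    , λ β β∈L β≤σ β-notLeast → Setoid.trans (partitionSetoid n) {β} {π} {σ}
        (minimal β β∈L (≤ₚ-trans {π = β} {σ} {π} β≤σ (≈⇒≥ {π = π} {σ} π≈σ)) β-notLeast) π≈σ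

module Embedding {J : Subset m → Partition n} (isEmbedding : IsOrderEmbedding J) where
  open IsOrderEmbedding isEmbedding

  injective : ∀ {S T} → J S ≈ₚ J T → S ≡ T
  injective {S} {T} JS≈JT = ⊆-antisym
    (cancel (≈⇒≤ {π = J S} {J T} JS≈JT)) (cancel (≈⇒≥ {π = J S} {J T} JS≈JT))

  -- Taking out of `T` an element that is not in `S` makes the partition strictly finer by `cancel`,
  -- which gains at least one block and costs one in cardinality. So the sum cannot fall on the way
  -- from `T` down to `S`.
  blockCount-chain : ∀ S T → S ⊆ T → blockCount (J T) + ∣ T ∣ ≤ blockCount (J S) + ∣ S ∣
  blockCount-chain S T = go T (⊂-wellFounded T)
    where
    go : ∀ T → Acc _⊂_ T → S ⊆ T → blockCount (J T) + ∣ T ∣ ≤ blockCount (J S) + ∣ S ∣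
    go T (acc rs) S⊆T with Fin.any? (λ i → (i ∈? T) ×-dec ¬? (i ∈? S))
    ... | no ∄i = ℕ.≤-reflexive (cong (λ U → blockCount (J U) + ∣ U ∣) (⊆-antisym
      (λ {i} i∈T → decidable-stable (i ∈? S) λ i∉S → ∄i (i , i∈T , i∉S)) S⊆T))
    ... | yes (i , i∈T , i∉S) = begin
      blockCount (J T) + ∣ T ∣              ≤⟨ ℕ.+-monoʳ-≤ (blockCount (J T)) (∣p∣≤1+∣p-x∣ T i) ⟩
      blockCount (J T) + suc ∣ T - i ∣      ≡⟨ ℕ.+-suc (blockCount (J T)) ∣ T - i ∣ ⟩
      suc (blockCount (J T)) + ∣ T - i ∣    ≤⟨ ℕ.+-monoˡ-≤ ∣ T - i ∣ fewer ⟩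
      blockCount (J (T - i)) + ∣ T - i ∣    ≤⟨ go (T - i) (rs (x∈p⇒p-x⊂p i∈T))
                                                (λ j∈S → x∈p∧x≢y⇒x∈p-y (S⊆T j∈S) λ { refl → i∉S j∈S }) ⟩
      blockCount (J S) + ∣ S ∣              ∎
      where
      open ℕ.≤-Reasoning
      fewer : blockCount (J T) < blockCount (J (T - i))
      fewer = blockCount-strict (J (T - i)) (J T) (mono (p─q⊆p T ⁅ i ⁆))
        λ JT≤ → x∉p-x T i (cancel JT≤ i∈T)

  blockCount-upper : ∀ S → blockCount (J S) + ∣ S ∣ ≤ n
  blockCount-upper S = begin
    blockCount (J S) + ∣ S ∣             ≤⟨ blockCount-chain ⊥ S ⊥⊆ ⟩
    blockCount (J ⊥) + ∣ ⊥ {n = m} ∣     ≡⟨ cong (blockCount (J ⊥) +_) (∣⊥∣≡0 m) ⟩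
    blockCount (J ⊥) + 0                 ≡⟨ ℕ.+-identityʳ _ ⟩
    blockCount (J ⊥)                     ≤⟨ blockCount≤n (J ⊥) ⟩
    n                                    ∎
    where open ℕ.≤-Reasoning

  -- The chain from `S` up to `⊤` ends in a partition that still has a block, which accounts for the
  -- `suc`.
  blockCount-lower : Fin n → ∀ S → suc m ≤ blockCount (J S) + ∣ S ∣
  blockCount-lower x S = begin
    1 + m                                ≡⟨ cong suc (sym (∣⊤∣≡n m)) ⟩
    1 + ∣ ⊤ {m} ∣                        ≤⟨ ℕ.+-monoˡ-≤ ∣ ⊤ {m} ∣ (1≤blockCount (J ⊤) x) ⟩
    blockCount (J ⊤) + ∣ ⊤ {m} ∣         ≤⟨ blockCount-chain S ⊤ ⊆⊤ ⟩
    blockCount (J S) + ∣ S ∣             ∎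
    where open ℕ.≤-Reasoning

  dimension<n : Fin n → m < n
  dimension<n x = ℕ.≤-trans (blockCount-lower x ⊥) (blockCount-upper ⊥)

  private
    S⟨_⟩ : Σ (Partition n) (Image J) → Subset m
    S⟨ _ , S , _ ⟩ = S

    el : Subset m → Σ (Partition n) (Image J)
    el S = J S , S , Setoid.refl (partitionSetoid n) {J S}

    toS : ∀ x y → proj₁ x ≤ₚ proj₁ y → S⟨ x ⟩ ⊆ S⟨ y ⟩
    toS (π , S , π≈) (σ , T , σ≈) π≤σ =
      cancel (≤ₚ-trans {π = J S} {π} {J T} (≈⇒≥ {π = π} {J S} π≈)
        (≤ₚ-trans {π = π} {σ} {J T} π≤σ (≈⇒≤ {π = σ} {J T} σ≈)))

    fromS : ∀ x y → S⟨ x ⟩ ⊆ S⟨ y ⟩ → proj₁ x ≤ₚ proj₁ y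
    fromS (π , S , π≈) (σ , T , σ≈) S⊆T =
      ≤ₚ-trans {π = π} {J S} {σ} (≈⇒≤ {π = π} {J S} π≈)
        (≤ₚ-trans {π = J S} {J T} {σ} (mono S⊆T) (≈⇒≥ {π = σ} {J T} σ≈))

  -- Every member carries a code `S`, and `toS` and `fromS` turn the order of partitions into
  -- inclusion of codes, so each law is that of the power set.
  Image-isBooleanLattice : IsBooleanLattice (Image J)
  Image-isBooleanLattice =
    (λ x y → el (S⟨ x ⟩ ∪ S⟨ y ⟩)) , (λ x y → el (S⟨ x ⟩ ∩ S⟨ y ⟩)) , (λ x → el (∁ S⟨ x ⟩)) ,
    el ⊤ , el ⊥ , record { isHeytingAlgebra = record
      { isBoundedLattice = record
        { isLattice = record
          { isPartialOrder = record
            { isPreorder = record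
              { isEquivalence = record
                { refl  = λ {x} → Setoid.refl (partitionSetoid n) {proj₁ x}
                ; sym   = λ {x} {y} → Setoid.sym (partitionSetoid n) {proj₁ x} {proj₁ y}
                ; trans = λ {x} {y} {z} →
                    Setoid.trans (partitionSetoid n) {proj₁ x} {proj₁ y} {proj₁ z}
                }
              ; reflexive = λ {x} {y} → ≈⇒≤ {π = proj₁ x} {proj₁ y}
              ; trans = λ {x} {y} {z} → ≤ₚ-trans {π = proj₁ x} {proj₁ y} {proj₁ z}
              }
            ; antisym = λ {x} {y} → ≤ₚ-antisym {π = proj₁ x} {proj₁ y}
            }
          ; supremum = λ x y →
              fromS x (el (S⟨ x ⟩ ∪ S⟨ y ⟩)) (p⊆p∪q S⟨ y ⟩) ,
              fromS y (el (S⟨ x ⟩ ∪ S⟨ y ⟩)) (q⊆p∪q S⟨ x ⟩ S⟨ y ⟩) ,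
              λ z x≤z y≤z → fromS (el (S⟨ x ⟩ ∪ S⟨ y ⟩)) z λ i∈ →
                case x∈p∪q⁻ S⟨ x ⟩ S⟨ y ⟩ i∈ of λ where
                  (inj₁ i∈x) → toS x z x≤z i∈x
                  (inj₂ i∈y) → toS y z y≤z i∈y
          ; infimum = λ x y →
              fromS (el (S⟨ x ⟩ ∩ S⟨ y ⟩)) x (p∩q⊆p S⟨ x ⟩ S⟨ y ⟩) ,
              fromS (el (S⟨ x ⟩ ∩ S⟨ y ⟩)) y (p∩q⊆q S⟨ x ⟩ S⟨ y ⟩) ,
              λ z z≤x z≤y → fromS z (el (S⟨ x ⟩ ∩ S⟨ y ⟩)) λ i∈ →
                x∈p∩q⁺ (toS z x z≤x i∈ , toS z y z≤y i∈)
          }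
        ; maximum = λ x → fromS x (el ⊤) ⊆⊤
        ; minimum = λ x → fromS (el ⊥) x ⊥⊆
        }
      ; exponential = λ w x y →
          (λ w∧x≤y → fromS w (el (∁ S⟨ x ⟩ ∪ S⟨ y ⟩)) λ {i} i∈w → case i ∈? S⟨ x ⟩ of λ where
            (yes i∈x) → x∈p∪q⁺ (inj₂ (toS (el (S⟨ w ⟩ ∩ S⟨ x ⟩)) y w∧x≤y (x∈p∩q⁺ (i∈w , i∈x))))
            (no i∉x) → x∈p∪q⁺ (inj₁ (x∉p⇒x∈∁p i∉x))) ,
          (λ w≤x⇨y → fromS (el (S⟨ w ⟩ ∩ S⟨ x ⟩)) y λ {i} i∈ →
            let i∈w , i∈x = x∈p∩q⁻ S⟨ w ⟩ S⟨ x ⟩ i∈ in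
            case x∈p∪q⁻ (∁ S⟨ x ⟩) S⟨ y ⟩ (toS w (el (∁ S⟨ x ⟩ ∪ S⟨ y ⟩)) w≤x⇨y i∈w) of λ where
              (inj₁ i∈∁x) → contradiction i∈x (x∈∁p⇒x∉p i∈∁x)
              (inj₂ i∈y) → i∈y)
      } }

  Image-hasSize : HasSize (Image J) (2 ^ m)
  Image-hasSize =
    tabulate (J ∘ decode)
    , SetoidUnique.tabulate⁺ (partitionSetoid n) (λ eq → decode-injective m (injective eq))
    , List.length-tabulate (J ∘ decode {m})
    , λ π → mk⇔
        (λ (S , π≈JS) → ∈-tabulate⁺ (J ∘ decode) π (encode S)
          (subst (λ T → π ≈ₚ J T) (sym (decode-encode S)) π≈JS))
        (λ π∈ → ∈⇒Image π (∈-tabulate⁻ (J ∘ decode) π π∈))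
    where
    ∈⇒Image : ∀ π → ∃[ k ] π ≈ₚ J (decode k) → Image J π
    ∈⇒Image π (k , π≈) = decode k , π≈

  J⁅_⁆-atom : ∀ i → IsAtom (Image J) (J ⁅ i ⁆)
  J⁅ i ⁆-atom = proj₂ (el ⁅ i ⁆) , notLeast , minimal
    where
    notLeast : ¬ IsLeast (Image J) (J ⁅ i ⁆)
    notLeast (_ , least) = ∉⊥ (cancel (least (J ⊥) (proj₂ (el ⊥))) (x∈⁅x⁆ i))
    minimal : ∀ β → Image J β → β ≤ₚ J ⁅ i ⁆ → ¬ IsLeast (Image J) β → β ≈ₚ J ⁅ i ⁆
    minimal β β∈@(S , β≈) β≤ β-notLeast with i ∈? S
    ... | yes i∈S = ≤ₚ-antisym {π = β} {J ⁅ i ⁆} β≤ (fromS (el ⁅ i ⁆) (β , β∈) (x∈p⇒⁅x⁆⊆p i∈S))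
    ... | no i∉S = ⊥-elim (β-notLeast
      (β∈ , λ σ σ∈ → fromS (β , β∈) (σ , σ∈) λ {j} j∈S →
        contradiction (subst (_∈ S) (x∈⁅y⁆⇒x≡y i (toS (β , β∈) (el ⁅ i ⁆) β≤ j∈S)) j∈S) i∉S))

  atom⇒J⁅⁆ : ∀ {α} → IsAtom (Image J) α → ∃[ i ] α ≈ₚ J ⁅ i ⁆
  atom⇒J⁅⁆ {α} (α∈@(S , α≈) , notLeast , minimal) with nonempty? S
  ... | yes (i , i∈S) = i , Setoid.sym (partitionSetoid n) {J ⁅ i ⁆} {α}
          (minimal (J ⁅ i ⁆) (proj₂ (el ⁅ i ⁆))
            (fromS (el ⁅ i ⁆) (α , α∈) (x∈p⇒⁅x⁆⊆p i∈S))
            (proj₁ (proj₂ J⁅ i ⁆-atom)))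
  ... | no empty = ⊥-elim (notLeast
    (α∈ , λ σ σ∈ → fromS (α , α∈) (σ , σ∈) λ {j} j∈S → contradiction (j , j∈S) empty))

  Image-hasDimension : HasDimension (Image J) m
  Image-hasDimension =
    tabulate (λ i → J ⁅ i ⁆)
    , SetoidUnique.tabulate⁺ (partitionSetoid n) (λ {i} {j} eq →
        x∈⁅y⁆⇒x≡y j (subst (i ∈_) (injective eq) (x∈⁅x⁆ i)))
    , List.length-tabulate (λ i → J ⁅ i ⁆)
    , λ π → mk⇔
        (λ atom → let i = atom⇒J⁅⁆ {π} atom in ∈-tabulate⁺ (λ i → J ⁅ i ⁆) π (proj₁ i) (proj₂ i))
        (λ π∈ → let i = ∈-tabulate⁻ (λ i → J ⁅ i ⁆) π π∈ in
          IsAtom-resp (Image-resp J) (J ⁅ proj₁ i ⁆) π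
            (Setoid.sym (partitionSetoid n) {π} {J ⁅ proj₁ i ⁆} (proj₂ i)) J⁅ proj₁ i ⁆-atom)

-- Partitions generated by families of pairs

-- The partition into connected components of the graph with edges `e i` for `i ∈ S`, built by one
-- merge per edge so that the loss of blocks can be counted.
generated : (Fin m → Fin n × Fin n) → Subset m → Partition n
generated {zero} e [] = discrete
generated {suc m} e (true ∷ S) = merge (generated (e ∘ suc) S) (proj₁ (e zero)) (proj₂ (e zero))
generated {suc m} e (false ∷ S) = generated (e ∘ suc) S

generated-joins : ∀ (e : Fin m → Fin n × Fin n) S {i} → i ∈ S → proj₁ (e i) ∼[ generated e S ] proj₂ (e i)
generated-joins e (true ∷ S) {zero} _ = merge-joins (generated (e ∘ suc) S) _ _
generated-joins e (true ∷ S) {suc i} i∈ =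
  merge⁺ (generated (e ∘ suc) S) _ _ (inj₁ (generated-joins (e ∘ suc) S (drop-there i∈)))
generated-joins e (false ∷ S) {suc i} i∈ = generated-joins (e ∘ suc) S (drop-there i∈)

-- Universal property that replaces induction on merges: a claim about connected vertices is proved
-- by choosing `Q`, be it another partition, a walk relation `Star`, or equality of colours.
generated-least : ∀ (e : Fin m → Fin n × Fin n) S {Q : Rel (Fin n) 0ℓ} → IsEquivalence Q →
  (∀ {i} → i ∈ S → Q (proj₁ (e i)) (proj₂ (e i))) → SameBlock (generated e S) ⇒ Q
generated-least {zero} e [] isEq _ x∼y with refl ← discrete⁻ x∼y = IsEquivalence.refl isEq
generated-least {suc m} e (true ∷ S) isEq joins =
  merge-least (generated (e ∘ suc) S) _ _ isEq
    (generated-least (e ∘ suc) S isEq (joins ∘ there)) (joins here)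
generated-least {suc m} e (false ∷ S) isEq joins =
  generated-least (e ∘ suc) S isEq (joins ∘ there)

n≤m+blockCount-generated : ∀ (e : Fin m → Fin n × Fin n) S → n ≤ m + blockCount (generated e S)
n≤m+blockCount-generated {zero} e [] = n≤blockCount-discrete
n≤m+blockCount-generated {suc m} {n} e (true ∷ S) = begin
  n                                                ≤⟨ n≤m+blockCount-generated (e ∘ suc) S ⟩
  m + blockCount (generated (e ∘ suc) S)           ≤⟨ ℕ.+-monoʳ-≤ m (blockCount-merge (generated (e ∘ suc) S) _ _) ⟩
  m + suc (blockCount (generated e (true ∷ S)))    ≡⟨ ℕ.+-suc m _ ⟩
  suc m + blockCount (generated e (true ∷ S))      ∎
  where open ℕ.≤-Reasoning
n≤m+blockCount-generated {suc m} e (false ∷ S) = ℕ.m≤n⇒m≤1+n (n≤m+blockCount-generated (e ∘ suc) S)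

generated-mono : ∀ (e : Fin m → Fin n × Fin n) {S T} → S ⊆ T →
  SameBlock (generated e S) ⇒ SameBlock (generated e T)
generated-mono e {S} {T} S⊆T =
  generated-least e S (∼-isEquivalence (generated e T)) (generated-joins e T ∘ S⊆T)

-- Independence in the cycle matroid: no pair is spanned by the others. Loops and repeated pairs are
-- excluded too, by taking `⊥` and a singleton for `S`.
Independent : (Fin m → Fin n × Fin n) → Set
Independent e = ∀ S i → proj₁ (e i) ∼[ generated e S ] proj₂ (e i) → i ∈ S

module _ (e : Fin m → Fin n × Fin n) (independent : Independent e) where

  generated-isOrderEmbedding : IsOrderEmbedding (generated e)
  generated-isOrderEmbedding = record
    { mono   = λ {S} {T} S⊆T → ∼⇒≤ {π = generated e S} {generated e T} (generated-mono e S⊆T)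
    ; cancel = λ {S} {T} S≤T {i} i∈S →
        independent T i (≤⇒∼ {π = generated e S} {generated e T} S≤T (generated-joins e S i∈S))
    }

  -- A pair i in S but not in T is never needed to connect vertices that are also connected by T:
  -- otherwise its ends would be connected by T together with the rest of S.
  generated-∩ : ∀ S T {x y} → x ∼[ generated e S ] y → x ∼[ generated e T ] y →
    x ∼[ generated e (S ∩ T) ] y
  generated-∩ S T = go S (⊂-wellFounded S)
    where
    go : ∀ S → Acc _⊂_ S → ∀ {x y} → x ∼[ generated e S ] y → x ∼[ generated e T ] y →
      x ∼[ generated e (S ∩ T) ] y
    go S (acc rs) {x} {y} x∼ₛy x∼ₜy with Fin.any? (λ i → (i ∈? S) ×-dec ¬? (i ∈? T))
    ... | no ∄i = generated-mono e (λ {i} i∈S → x∈p∩q⁺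
            (i∈S , decidable-stable (i ∈? T) λ i∉T → ∄i (i , i∈S , i∉T))) x∼ₛy
    ... | yes (i , i∈S , i∉T) = case merge⁻ (generated e S′) a b (split x∼ₛy) of λ where
        (inj₁ x∼y) → generated-mono e S′∩T⊆S∩T (go S′ (rs (x∈p⇒p-x⊂p i∈S)) x∼y x∼ₜy)
        (inj₂ (inj₁ (x∼a , b∼y))) → contradiction
          (∼-sym U (inS′ x∼a) ∙ inT x∼ₜy ∙ ∼-sym U (inS′ b∼y)) a≁b
        (inj₂ (inj₂ (x∼b , a∼y))) → contradiction
          (inS′ a∼y ∙ ∼-sym U (inT x∼ₜy) ∙ inS′ x∼b) a≁b
      where
      S′ = S - i
      a = proj₁ (e i)
      b = proj₂ (e i)
      U = generated e (S′ ∪ T)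
      infixr 5 _∙_
      _∙_ : ∀ {x y z} → x ∼[ U ] y → y ∼[ U ] z → x ∼[ U ] z
      _∙_ = ∼-trans U
      inS′ : SameBlock (generated e S′) ⇒ SameBlock U
      inS′ = generated-mono e (p⊆p∪q T)
      inT : SameBlock (generated e T) ⇒ SameBlock U
      inT = generated-mono e (q⊆p∪q S′ T)
      a≁b : ¬ a ∼[ U ] b
      a≁b a∼b = case x∈p∪q⁻ S′ T (independent (S′ ∪ T) i a∼b) of λ where
        (inj₁ i∈S′) → x∉p-x S i i∈S′
        (inj₂ i∈T) → i∉T i∈T
      S′∩T⊆S∩T : S′ ∩ T ⊆ S ∩ T
      S′∩T⊆S∩T j∈ = let j∈S′ , j∈T = x∈p∩q⁻ S′ T j∈ in x∈p∩q⁺ (p─q⊆p S ⁅ i ⁆ j∈S′ , j∈T)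
      split : SameBlock (generated e S) ⇒ SameBlock (merge (generated e S′) a b)
      split = generated-least e S (∼-isEquivalence (merge (generated e S′) a b)) λ {j} j∈S →
        case j Fin.≟ i of λ where
          (yes refl) → merge-joins (generated e S′) a b
          (no j≢i) → merge⁺ (generated e S′) a b
            (inj₁ (generated-joins e S′ (x∈p∧x≢y⇒x∈p-y j∈S j≢i)))

  -- `IsMeet` and `IsJoin` determine `μ` by a universal property, so `μ` is compared with the
  -- partitions coded by `S ∩ T` and `S ∪ T`. The join follows from `generated-least`; the meet
  -- rests on `generated-∩`, hence on independence.
  Image-generated-isBooleanSublattice : IsBooleanSublattice (Image (generated e))
  Image-generated-isBooleanSublattice = record
    { respects = λ {π} {σ} → Image-resp (generated e) π σ
    ; meet-closed = λ {π} {σ} {μ} → meets π σ μ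
    ; join-closed = λ {π} {σ} {μ} → joins π σ μ
    ; isBooleanLattice = Embedding.Image-isBooleanLattice generated-isOrderEmbedding
    }
    where
    to : ∀ π S → π ≈ₚ generated e S → SameBlock π ⇒ SameBlock (generated e S)
    to π S π≈S = ≤⇒∼ {π = π} {generated e S} (≈⇒≤ {π = π} {generated e S} π≈S)
    from : ∀ π S → π ≈ₚ generated e S → SameBlock (generated e S) ⇒ SameBlock π
    from π S π≈S = ≤⇒∼ {π = generated e S} {π} (≈⇒≥ {π = π} {generated e S} π≈S)

    meets : ∀ π σ μ → Image (generated e) π → Image (generated e) σ → IsMeet π σ μ → Image (generated e) μ
    meets π σ μ (S , π≈S) (T , σ≈T) (μ≤π , μ≤σ , greatest) =
      S ∩ T , ≤ₚ-antisym {π = μ} {generated e (S ∩ T)}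
        (∼⇒≤ {π = μ} {generated e (S ∩ T)} λ x∼y → generated-∩ S T
          (to π S π≈S (≤⇒∼ {π = μ} {π} μ≤π x∼y)) (to σ T σ≈T (≤⇒∼ {π = μ} {σ} μ≤σ x∼y)))
        (greatest (generated e (S ∩ T))
          (∼⇒≤ {π = generated e (S ∩ T)} {π} (from π S π≈S ∘ generated-mono e (p∩q⊆p S T)))
          (∼⇒≤ {π = generated e (S ∩ T)} {σ} (from σ T σ≈T ∘ generated-mono e (p∩q⊆q S T))))

    joins : ∀ π σ μ → Image (generated e) π → Image (generated e) σ → IsJoin π σ μ → Image (generated e) μ
    joins π σ μ (S , π≈S) (T , σ≈T) (π≤μ , σ≤μ , least) =
      S ∪ T , ≤ₚ-antisym {π = μ} {generated e (S ∪ T)}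
        (least (generated e (S ∪ T))
          (∼⇒≤ {π = π} {generated e (S ∪ T)} (generated-mono e (p⊆p∪q T) ∘ to π S π≈S))
          (∼⇒≤ {π = σ} {generated e (S ∪ T)} (generated-mono e (q⊆p∪q S T) ∘ to σ T σ≈T)))
        (∼⇒≤ {π = generated e (S ∪ T)} {μ} (generated-least e (S ∪ T) (∼-isEquivalence μ) λ {i} i∈ →
          case x∈p∪q⁻ S T i∈ of λ where
            (inj₁ i∈S) → ≤⇒∼ {π = π} {μ} π≤μ (from π S π≈S (generated-joins e S i∈S))
            (inj₂ i∈T) → ≤⇒∼ {π = σ} {μ} σ≤μ (from σ T σ≈T (generated-joins e T i∈T))))

-- Boolean algebras with finitely many atoms

module AtomicBooleanAlgebra (A : BooleanAlgebra 0ℓ 0ℓ 0ℓ) where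
  open BooleanAlgebra A
    renaming (refl to ≤-refl; trans to ≤-trans; ⊤ to 𝟏; ⊥ to 𝟎; ¬_ to compl; _≤_ to infix 4 _≤ᴬ_)
  open HeytingAlgebraProperties heytingAlgebra using (swap-transpose-⇨; ∧-distribˡ-∨-≤)

  ⋁ : (Fin m → Carrier) → Subset m → Carrier
  ⋁ {zero} α [] = 𝟎
  ⋁ {suc m} α (true ∷ S) = α zero ∨ ⋁ (α ∘ suc) S
  ⋁ {suc m} α (false ∷ S) = ⋁ (α ∘ suc) S

  ⋁-upper : ∀ (α : Fin m → Carrier) S {i} → i ∈ S → α i ≤ᴬ ⋁ α S
  ⋁-upper α (true ∷ S) {zero} _ = x≤x∨y _ _
  ⋁-upper α (true ∷ S) {suc i} i∈ = ≤-trans (⋁-upper (α ∘ suc) S (drop-there i∈)) (y≤x∨y _ _)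
  ⋁-upper α (false ∷ S) {suc i} i∈ = ⋁-upper (α ∘ suc) S (drop-there i∈)

  ⋁-least : ∀ (α : Fin m → Carrier) S {z} → (∀ {i} → i ∈ S → α i ≤ᴬ z) → ⋁ α S ≤ᴬ z
  ⋁-least {zero} α [] _ = minimum _
  ⋁-least {suc m} α (true ∷ S) α≤z = ∨-least (α≤z here) (⋁-least (α ∘ suc) S (α≤z ∘ there))
  ⋁-least {suc m} α (false ∷ S) α≤z = ⋁-least (α ∘ suc) S (α≤z ∘ there)

  -- By adjunction each `α i` lies below `x ⇨ 𝟎`, hence so does their join.
  ∧-⋁-disjoint : ∀ (α : Fin m → Carrier) S {x} → (∀ {i} → i ∈ S → x ∧ α i ≤ᴬ 𝟎) → x ∧ ⋁ α S ≤ᴬ 𝟎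
  ∧-⋁-disjoint α S disj = ≤-trans (∧-greatest (x∧y≤y _ _) (x∧y≤x _ _))
    (transpose-∧ (⋁-least α S (swap-transpose-⇨ ∘ disj)))

  module _ (α : Fin m → Carrier)
           (_≤?_ : ∀ x y → Dec (x ≤ᴬ y))
           (nonzero : ∀ i → ¬ (α i ≤ᴬ 𝟎))
           (minimal : ∀ i b → b ≤ᴬ α i → ¬ (b ≤ᴬ 𝟎) → α i ≤ᴬ b)
           (distinct : ∀ i j → α i ≈ α j → i ≡ j)
           (atomic : ∀ z → (∀ i → ¬ (α i ≤ᴬ z)) → z ≤ᴬ 𝟎)
           where

    atoms-disjoint : ∀ i j → i ≢ j → α i ∧ α j ≤ᴬ 𝟎
    atoms-disjoint i j i≢j = decidable-stable (_ ≤? 𝟎) λ nonzero∧ → i≢j (distinct i j (antisym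
      (≤-trans (minimal i (α i ∧ α j) (x∧y≤x _ _) nonzero∧) (x∧y≤y _ _))
      (≤-trans (minimal j (α i ∧ α j) (x∧y≤y _ _) nonzero∧) (x∧y≤x _ _))))

    α≤⋁⇒∈ : ∀ S i → α i ≤ᴬ ⋁ α S → i ∈ S
    α≤⋁⇒∈ S i α≤⋁ = decidable-stable (i ∈? S) λ i∉S → nonzero i
      (≤-trans (∧-greatest ≤-refl α≤⋁)
        (∧-⋁-disjoint α S λ j∈S → atoms-disjoint i _ λ { refl → i∉S j∈S }))

    ⋁-mono : ∀ {S T} → S ⊆ T → ⋁ α S ≤ᴬ ⋁ α T
    ⋁-mono {S} {T} S⊆T = ⋁-least α S (⋁-upper α T ∘ S⊆T)

    ⋁-cancel : ∀ {S T} → ⋁ α S ≤ᴬ ⋁ α T → S ⊆ T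
    ⋁-cancel {S} {T} ⋁S≤⋁T i∈S = α≤⋁⇒∈ T _ (≤-trans (⋁-upper α S i∈S) ⋁S≤⋁T)

    -- An atom below `x ∧ compl y` is below `x`, hence among those joined to `y`, and so lies below
    -- both `y` and its complement. Thus `x ∧ compl y` is zero, and distributivity leaves `x ≤ᴬ y`.
    ⋁-complete : ∀ x → x ≈ ⋁ α (subsetOf λ i → α i ≤? x)
    ⋁-complete x = antisym x≤y (⋁-least α S (∈-subsetOf⁻ (λ i → α i ≤? x)))
      where
      S = subsetOf λ i → α i ≤? x
      y = ⋁ α S
      difference-zero : x ∧ compl y ≤ᴬ 𝟎
      difference-zero = atomic _ λ i α≤ → nonzero i (≤-trans
        (∧-greatest (≤-trans α≤ (x∧y≤y _ _))
          (⋁-upper α S (∈-subsetOf⁺ (λ i → α i ≤? x) (≤-trans α≤ (x∧y≤x _ _)))))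
        (transpose-∧ (x≤x∨y _ _)))
      x≤y : x ≤ᴬ y
      x≤y = ≤-trans
        (∧-greatest ≤-refl (≤-trans (maximum x) (transpose-⇨ (x∧y≤y _ _))))
        (≤-trans (∧-distribˡ-∨-≤ x (compl y) y)
          (∨-least (≤-trans difference-zero (minimum y)) (x∧y≤y _ _)))

-- Boolean sublattices as cubes over their atoms

∈⇒∈ₚ : ∀ {π : Partition n} {πs} → π ∈ˡ πs → π ∈ₚ πs
∈⇒∈ₚ {n} {π} (here refl) = here (Setoid.refl (partitionSetoid n) {π})
∈⇒∈ₚ (there π∈) = there (∈⇒∈ₚ π∈)

lookup-injective : ∀ {c ℓ} (S : Setoid c ℓ) {xs} → SetoidUnique.Unique S xs → ∀ i j →
  Setoid._≈_ S (List.lookup xs i) (List.lookup xs j) → i ≡ j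
lookup-injective S (_ ∷ _) zero zero _ = refl
lookup-injective S (x∉ ∷ _) zero (suc j) x≈ = ⊥-elim (All.lookup x∉ (∈-lookup j) x≈)
lookup-injective S (x∉ ∷ _) (suc i) zero ≈x =
  ⊥-elim (All.lookup x∉ (∈-lookup i) (Setoid.sym S ≈x))
lookup-injective S (_ ∷ xs!) (suc i) (suc j) eq = cong suc (lookup-injective S xs! i j eq)

module _ {L : Pred (Partition n) 0ℓ} where

  -- Passing to a strictly smaller element increases the number of blocks, so the descent ends.
  no-atom-below⇒least : (⊥ᴸ : Partition n) → IsLeast L ⊥ᴸ →
    ∀ π → L π → (∀ α → IsAtom L α → ¬ α ≤ₚ π) → IsLeast L π
  no-atom-below⇒least ⊥ᴸ (⊥∈L , least) π = go π (ℕ.<-wellFounded (n ∸ blockCount π))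
    where
    isLeast? : ∀ π → L π → Dec (IsLeast L π)
    isLeast? π π∈L with ≤ₚ? π ⊥ᴸ
    ... | yes π≤⊥ = yes (π∈L , λ σ σ∈L → ≤ₚ-trans {π = π} {⊥ᴸ} {σ} π≤⊥ (least σ σ∈L))
    ... | no π≰⊥ = no λ (_ , π-least) → π≰⊥ (π-least ⊥ᴸ ⊥∈L)

    go : ∀ π → Acc _<_ (n ∸ blockCount π) → L π → (∀ α → IsAtom L α → ¬ α ≤ₚ π) → IsLeast L π
    -- Otherwise `π` would itself be an atom: an element strictly below it has no atom below it
    -- either, so it is least by induction.
    go π (acc rs) π∈L no-atom = decidable-stable (isLeast? π π∈L)
      λ notLeast → no-atom π
        ( π∈L , notLeast
        , λ β β∈L β≤π β-notLeast → decidable-stable (≈ₚ? β π) λ β≉π → β-notLeast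
            (go β (rs (ℕ.∸-monoʳ-<
                (blockCount-strict β π β≤π λ π≤β → β≉π (≤ₚ-antisym {π = β} {π} β≤π π≤β))
                (blockCount≤n β)))
              β∈L (λ α atom α≤β → no-atom α atom (≤ₚ-trans {π = α} {β} {π} α≤β β≤π))))
        (≤ₚ-refl {π = π})

  -- `J S` is the join, taken in `L`, of the atoms listed at the positions in `S`. The list holds
  -- only the atoms of `L`; that every element is a join of atoms comes from the descent in Part(V).
  isBooleanSublattice⇒Image : IsBooleanSublattice L → ∀ {d} → HasDimension L d →
    ∃[ J ] (IsOrderEmbedding {d} {n} J × L ≐ Image J)
  isBooleanSublattice⇒Image
    record { respects = respects ; isBooleanLattice = _ , _ , _ , _ , 𝟎 , isBA } (αs , αs! , refl , atom⇔) =
    proj₁ ∘ ⋁ α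
    , record
      { mono   = ⋁-mono α ≤? nonzero minimal distinct atomic
      ; cancel = ⋁-cancel α ≤? nonzero minimal distinct atomic
      }
    , (λ {π} π∈L → subsetOf (λ i → ≤? (α i) (π , π∈L)) ,
        ⋁-complete α ≤? nonzero minimal distinct atomic (π , π∈L))
    , λ {π} (S , π≈) → respects {proj₁ (⋁ α S)} {π}
        (Setoid.sym (partitionSetoid n) {π} {proj₁ (⋁ α S)} π≈) (proj₂ (⋁ α S))
    where
    A : BooleanAlgebra 0ℓ 0ℓ 0ℓ
    A = record { isBooleanAlgebra = isBA }
    open AtomicBooleanAlgebra A
    open BooleanAlgebra A using (Carrier) renaming (_≤_ to _≤ᴬ_)

    atom : ∀ i → IsAtom L (List.lookup αs i)
    atom i = Equivalence.from (atom⇔ (List.lookup αs i))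
      (∈⇒∈ₚ (∈-lookup {xs = αs} i))

    α : Fin (List.length αs) → Carrier
    α i = List.lookup αs i , proj₁ (atom i)

    ≤? : ∀ x y → Dec (x ≤ᴬ y)
    ≤? x y = ≤ₚ? (proj₁ x) (proj₁ y)

    𝟎-least : IsLeast L (proj₁ 𝟎)
    𝟎-least = proj₂ 𝟎 , λ σ σ∈L → BooleanAlgebra.minimum A (σ , σ∈L)

    ≤𝟎⇒least : ∀ x → x ≤ᴬ 𝟎 → IsLeast L (proj₁ x)
    ≤𝟎⇒least x x≤𝟎 = proj₂ x , λ σ σ∈L →
      ≤ₚ-trans {π = proj₁ x} {proj₁ 𝟎} {σ} x≤𝟎 (proj₂ 𝟎-least σ σ∈L)

    nonzero : ∀ i → ¬ (α i ≤ᴬ 𝟎)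
    nonzero i α≤𝟎 = proj₁ (proj₂ (atom i)) (≤𝟎⇒least (α i) α≤𝟎)

    minimal : ∀ i b → b ≤ᴬ α i → ¬ (b ≤ᴬ 𝟎) → α i ≤ᴬ b
    minimal i b b≤α b≰𝟎 = ≈⇒≥ {π = proj₁ b} {proj₁ (α i)}
      (proj₂ (proj₂ (atom i)) (proj₁ b) (proj₂ b) b≤α λ (_ , b-least) →
        b≰𝟎 (b-least (proj₁ 𝟎) (proj₂ 𝟎)))

    distinct : ∀ i j → proj₁ (α i) ≈ₚ proj₁ (α j) → i ≡ j
    distinct = lookup-injective (partitionSetoid n) αs!

    atomic : ∀ z → (∀ i → ¬ (α i ≤ᴬ z)) → z ≤ᴬ 𝟎
    atomic (z , z∈L) no-α = proj₂ (no-atom-below⇒least (proj₁ 𝟎) 𝟎-least z z∈L no-atom) (proj₁ 𝟎) (proj₂ 𝟎)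
      where
      no-atom : ∀ β → IsAtom L β → ¬ β ≤ₚ z
      no-atom β β-atom β≤z = no-α (Any.index β∈)
        (≤ₚ-trans {π = List.lookup αs (Any.index β∈)} {β} {z}
          (≈⇒≥ {π = β} {List.lookup αs (Any.index β∈)} (Any.lookup-index β∈)) β≤z)
        where β∈ = Equivalence.to (atom⇔ β) β-atom

-- Trees as independent families of edges

Joins : Fin n × Fin n → Rel (Fin n) 0ℓ
Joins (a , b) u v = (a ≡ u × b ≡ v) ⊎ (a ≡ v × b ≡ u)

Joins-sym : ∀ {p : Fin n × Fin n} → Symmetric (Joins p)
Joins-sym (inj₁ eqs) = inj₂ eqs
Joins-sym (inj₂ eqs) = inj₁ eqs

-- Relates a family of oriented pairs to a symmetric relation; excluding repetitions is left to
-- `Independent`.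
record Enumerates (e : Fin m → Fin n × Fin n) (E : Rel (Fin n) 0ℓ) : Set where
  field
    symmetric : Symmetric E
    sound     : ∀ i → E (proj₁ (e i)) (proj₂ (e i))
    complete  : ∀ {u v} → E u v → ∃[ i ] Joins (e i) u v

Star-isEquivalence : ∀ {R : Rel (Fin n) 0ℓ} → Symmetric R → IsEquivalence (Star R)
Star-isEquivalence R-sym = record { refl = ε ; sym = reverse R-sym ; trans = _◅◅_ }

Joins⇒∼ : ∀ (π : Partition n) {a b u v} → Joins (a , b) u v → a ∼[ π ] b → u ∼[ π ] v
Joins⇒∼ π (inj₁ (refl , refl)) a∼b = a∼b
Joins⇒∼ π (inj₂ (refl , refl)) a∼b = ∼-sym π a∼b

∼⇒Joins : ∀ (π : Partition n) {a b u v} → Joins (a , b) u v → u ∼[ π ] v → a ∼[ π ] b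
∼⇒Joins π (inj₁ (refl , refl)) u∼v = u∼v
∼⇒Joins π (inj₂ (refl , refl)) u∼v = ∼-sym π u∼v

ConnectedBlocks : Rel (Fin n) 0ℓ → Pred (Partition n) 0ℓ
ConnectedBlocks E π = All (IsConnectedSet E) (blocks π)

module _ {e : Fin m → Fin n × Fin n} {E : Rel (Fin n) 0ℓ} (enumerates : Enumerates e E) where
  open Enumerates enumerates

  -- The code of `π` collects the pairs with both ends in a common block. A walk inside a block uses
  -- only such pairs, so they generate `π`.
  connectedBlocks⇒generated : ∀ π → ConnectedBlocks E π → Image (generated e) π
  connectedBlocks⇒generated π connected = S , ≤ₚ-antisym {π = π} {generated e S}
    (∼⇒≤ {π = π} {generated e S} λ { (B , B∈ , x∈B , y∈B) →
      fold (SameBlock (generated e S)) (λ step → ∼-trans (generated e S) (edge B∈ step))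
        (∼-refl (generated e S)) (proj₂ (All.lookup connected B∈) x∈B y∈B) })
    (∼⇒≤ {π = generated e S} {π}
      (generated-least e S (∼-isEquivalence π) (∈-subsetOf⁻ S?)))
    where
    S? = λ i → ∼? π (proj₁ (e i)) (proj₂ (e i))
    S = subsetOf S?
    edge : ∀ {B u v} → B ∈ˡ blocks π → u ∈ B × v ∈ B × E u v → u ∼[ generated e S ] v
    edge B∈ (u∈B , v∈B , uEv) with i , joins ← complete uEv =
      Joins⇒∼ (generated e S) joins
        (generated-joins e S (∈-subsetOf⁺ S? (∼⇒Joins π joins (_ , B∈ , u∈B , v∈B))))

  -- `generated-least` is applied to walks each of whose steps stays within a block of `π`; such a
  -- walk never leaves its block, as the induced subgraph requires.
  generated⇒connectedBlocks : ∀ π → Image (generated e) π → ConnectedBlocks E π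
  generated⇒connectedBlocks π (S , π≈S) = All.tabulate λ {B} B∈ →
    All.lookup (nonempty π) B∈ , λ x∈B y∈B → restrict B∈ x∈B (walk (_ , B∈ , x∈B , y∈B))
    where
    walk : SameBlock π ⇒ Star (λ u v → u ∼[ π ] v × E u v)
    walk = generated-least e S
        (Star-isEquivalence λ (u∼v , uEv) → ∼-sym π u∼v , symmetric uEv)
        (λ {i} i∈S →
          (≤⇒∼ {π = generated e S} {π} (≈⇒≥ {π = π} {generated e S} π≈S) (generated-joins e S i∈S)
            , sound i) ◅ ε)
      ∘ ≤⇒∼ {π = π} {generated e S} (≈⇒≤ {π = π} {generated e S} π≈S)
    restrict : ∀ {B x y} → B ∈ˡ blocks π → x ∈ B → Star (λ u v → u ∼[ π ] v × E u v) x y →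
      Star (λ u v → u ∈ B × v ∈ B × E u v) x y
    restrict B∈ x∈B ε = ε
    restrict B∈ u∈B ((u∼v , uEv) ◅ walk) = (u∈B , v∈B , uEv) ◅ restrict B∈ v∈B walk
      where v∈B = ∼⇒∈ π B∈ u∈B u∼v

  Image-generated≐ConnectedBlocks : Image (generated e) ≐ ConnectedBlocks E
  Image-generated≐ConnectedBlocks =
    (λ {π} → generated⇒connectedBlocks π) , (λ {π} → connectedBlocks⇒generated π)

-- Simple paths, and the edges of a tree as bridges

data Path (R : Rel (Fin n) 0ℓ) : Fin n → List (Fin n) → Fin n → Set where
  []  : ∀ {u} → Path R u [] u
  _∷_ : ∀ {u v w zs} → R u v → Path R v zs w → Path R u (v ∷ zs) w

module _ {R : Rel (Fin n) 0ℓ} where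

  suffix-path : ∀ {u v w zs} → Path R v zs w → Unique (v ∷ zs) → u ∈ˡ v ∷ zs →
    ∃[ zs′ ] Path R u zs′ w × Unique (u ∷ zs′)
  suffix-path path zs! (here refl) = _ , path , zs!
  suffix-path (_ ∷ path) (_ ∷ zs!) (there u∈) = suffix-path path zs! u∈

  -- Loop erasure: if the new starting vertex already occurs on the simple path, the path is cut
  -- down to its suffix from there.
  simple-path : ∀ {u v} → Star R u v → ∃[ zs ] Path R u zs v × Unique (u ∷ zs)
  simple-path ε = [] , [] , [] ∷ []
  simple-path {u} (_◅_ {j = w} step walk) with zs , path , zs! ← simple-path walk with Any.any? (u Fin.≟_) (w ∷ zs)
  ... | yes u∈ = suffix-path path zs! u∈
  ... | no u∉ = w ∷ zs , step ∷ path , All.¬Any⇒All¬ _ u∉ ∷ zs!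

  path-linked : ∀ {E : Rel (Fin n) 0ℓ} {u v w zs} → R ⇒ E → Path R u zs v → E v w → Linked E (u ∷ zs ++ w ∷ [])
  path-linked R⇒E [] vEw = vEw ∷ [-]
  path-linked R⇒E (step ∷ path) vEw = R⇒E step ∷ path-linked R⇒E path vEw

Avoiding : Rel (Fin n) 0ℓ → Fin n → Fin n → Rel (Fin n) 0ℓ
Avoiding E x y u v = E u v × ¬ Joins (x , y) u v

module _ (T : Tree n) where

  -- A simple path that avoids the edge is closed up by it to a cycle. Paths of fewer than two steps
  -- are handled apart, since a cycle has three vertices: they would be a loop or the edge itself.
  edge-is-bridge : ∀ {x y} → Edge T x y → ¬ Star (Avoiding (Edge T) x y) x y
  edge-is-bridge {x} {y} xEy walk with simple-path walk
  ... | [] , [] , _ = Tree.irreflexive T refl xEy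
  ... | z ∷ [] , (_ , avoids) ∷ [] , _ = avoids (inj₁ (refl , refl))
  ... | zs@(_ ∷ _ ∷ _) , path , zs! = Tree.acyclic T x zs
    (s≤s (s≤s z≤n) , zs! , path-linked proj₁ path (Tree.symmetric T xEy))

  private
    -- Each edge is listed once, from its smaller end.
    Ascending? : ∀ ((u , v) : Fin n × Fin n) → Dec (u Fin.< v × Edge T u v)
    Ascending? (u , v) = (u Fin.<? v) ×-dec Tree.edge? T u v

    edges : List (Fin n × Fin n)
    edges = filter Ascending? (cartesianProduct (allFin n) (allFin n))

    e : Fin (length edges) → Fin n × Fin n
    e = List.lookup edges

    edges! : Unique edges
    edges! = Unique.filter⁺ Ascending?
      (Unique.cartesianProduct⁺ (Unique.allFin⁺ n) (Unique.allFin⁺ n))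

    e-ascending : ∀ i → proj₁ (e i) Fin.< proj₂ (e i) × Edge T (proj₁ (e i)) (proj₂ (e i))
    e-ascending i = proj₂ (∈-filter⁻ Ascending? {xs = cartesianProduct (allFin n) (allFin n)}
      (∈-lookup {xs = edges} i))

    index : ∀ {u v} → u Fin.< v → Edge T u v → ∃[ i ] e i ≡ (u , v)
    index {u} {v} u<v uEv = Any.index uv∈ , sym (Any.lookup-index uv∈)
      where
      uv∈ : (u , v) ∈ˡ edges
      uv∈ = ∈-filter⁺ Ascending? (∈-cartesianProduct⁺ (∈-allFin u) (∈-allFin v)) (u<v , uEv)

    e-enumerates : Enumerates e (Edge T)
    e-enumerates = record
      { symmetric = Tree.symmetric T
      ; sound     = proj₂ ∘ e-ascending
      ; complete  = complete
      }
      where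
      complete : ∀ {u v} → Edge T u v → ∃[ i ] Joins (e i) u v
      complete {u} {v} uEv with Fin.<-cmp u v
      ... | tri< u<v _ _ = let i , eq = index u<v uEv in i , inj₁ (cong proj₁ eq , cong proj₂ eq)
      ... | tri≈ _ u≡v _ = ⊥-elim (Tree.irreflexive T u≡v uEv)
      ... | tri> _ _ v<u = let i , eq = index v<u (Tree.symmetric T uEv) in
                           i , inj₂ (cong proj₁ eq , cong proj₂ eq)

    -- If `i ∉ S`, the pairs in `S` are edges other than `e i`, so a connection of its ends by `S`
    -- would be a walk around a bridge.
    e-independent : Independent e
    e-independent S i a∼b = decidable-stable (i ∈? S) λ i∉S →
      edge-is-bridge (proj₂ (e-ascending i))
        (generated-least e S
          (Star-isEquivalence λ (uEv , avoids) → Tree.symmetric T uEv , avoids ∘ Joins-sym)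
          (λ {j} j∈S → (proj₂ (e-ascending j) , other i j λ { refl → i∉S j∈S }) ◅ ε)
          a∼b)
      where
      other : ∀ i j → i ≢ j → ¬ Joins (e i) (proj₁ (e j)) (proj₂ (e j))
      other i j i≢j (inj₁ (eq₁ , eq₂)) =
        i≢j (lookup-injective (setoid (Fin n × Fin n)) edges! i j (cong₂ _,_ eq₁ eq₂))
      -- The same edge listed in reverse contradicts that both listings ascend.
      other i j i≢j (inj₂ (eq₁ , eq₂)) = Fin.<-asym (proj₁ (e-ascending i))
        (subst₂ Fin._<_ (sym eq₂) (sym eq₁) (proj₁ (e-ascending j)))

    e-spanning : ∀ x y → x ∼[ generated e ⊤ ] y
    e-spanning x y = fold (SameBlock (generated e ⊤))
      (λ (_ , _ , uEv) → let i , joins = Enumerates.complete e-enumerates uEv in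
        ∼-trans (generated e ⊤) (Joins⇒∼ (generated e ⊤) joins (generated-joins e ⊤ ∈⊤)))
      (∼-refl (generated e ⊤)) (proj₂ (Tree.connected T) ∈⊤ ∈⊤)

    -- Both halves count blocks: merging along the edges goes from `n` blocks to one, losing at most
    -- one per edge, while an independent family spans a cube, whose dimension is below `n`.
    edgeCount : Fin n → length edges ≡ n ∸ 1
    edgeCount x = sym (ℕ.≤-antisym
      (ℕ.m≤n+o⇒m∸n≤o n 1 (begin
        n                                                  ≤⟨ n≤m+blockCount-generated e ⊤ ⟩
        length edges + blockCount (generated e ⊤)          ≤⟨ ℕ.+-monoʳ-≤ (length edges)
                                                                (∼⇒blockCount≤1 (generated e ⊤) x (e-spanning x)) ⟩
        length edges + 1                                   ≡⟨ ℕ.+-comm (length edges) 1 ⟩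
        1 + length edges                                   ∎))
      (ℕ.∸-monoˡ-≤ 1 (Embedding.dimension<n (generated-isOrderEmbedding e e-independent) x)))
      where open ℕ.≤-Reasoning

  edgeEnumeration : Fin n →
    Σ[ e ∈ (Fin (n ∸ 1) → Fin n × Fin n) ] Independent e × Enumerates e (Edge T)
  edgeEnumeration x = subst
    (λ m → Σ[ e ∈ (Fin m → Fin n × Fin n) ] Independent e × Enumerates e (Edge T))
    (edgeCount x) (e , e-independent , e-enumerates)

-- The tree of an independent family

module _ (e : Fin m → Fin n × Fin n) (independent : Independent e) where
  private
    EdgeOf : Rel (Fin n) 0ℓ
    EdgeOf u v = ∃[ i ] Joins (e i) u v

    EdgeOf-sym : Symmetric EdgeOf
    EdgeOf-sym (i , joins) = i , Joins-sym joins

    avoiding⇒∼ : ∀ i {x y u v} → Joins (e i) x y → EdgeOf u v → ¬ Joins (x , y) u v →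
      u ∼[ generated e (⊤ - i) ] v
    avoiding⇒∼ i i-joins (j , j-joins) avoids = Joins⇒∼ (generated e (⊤ - i)) j-joins
      (generated-joins e (⊤ - i) (x∈p∧x≢y⇒x∈p-y ∈⊤ λ { refl → avoids (same i-joins j-joins) }))
      where
      same : ∀ {p : Fin n × Fin n} {x y u v} → Joins p x y → Joins p u v → Joins (x , y) u v
      same (inj₁ (refl , refl)) uv = uv
      same (inj₂ (refl , refl)) uv = Joins-sym (swap-pair uv)
        where
        swap-pair : ∀ {a b u v : Fin n} → Joins (a , b) u v → Joins (b , a) v u
        swap-pair (inj₁ (p , q)) = inj₁ (q , p)
        swap-pair (inj₂ (p , q)) = inj₂ (q , p)

    -- The rest of a cycle never uses the pair of `x` and `y`: its inner steps do not touch `x`, and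
    -- its closing step into `x` starts at a vertex other than `y`.
    arc⇒∼ : ∀ i {x y} → Joins (e i) x y → ∀ z zs → Linked EdgeOf (z ∷ zs ++ x ∷ []) →
      All (x ≢_) (z ∷ zs) → All (y ≢_) (z ∷ zs) → z ∼[ generated e (⊤ - i) ] x
    arc⇒∼ i joins z [] (zx ∷ [-]) (x≢z ∷ []) (y≢z ∷ []) =
      avoiding⇒∼ i joins zx λ { (inj₁ (x≡z , _)) → x≢z x≡z ; (inj₂ (_ , y≡z)) → y≢z y≡z }
    arc⇒∼ i joins z (w ∷ zs) (zw ∷ linked) (x≢z ∷ x≢w ∷ x≢zs) (_ ∷ y≢) =
      ∼-trans (generated e (⊤ - i))
        (avoiding⇒∼ i joins zw λ { (inj₁ (x≡z , _)) → x≢z x≡z ; (inj₂ (x≡w , _)) → x≢w x≡w })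
        (arc⇒∼ i joins w zs linked (x≢w ∷ x≢zs) y≢)

    -- Going round the cycle the other way connects the ends of its first edge by the remaining
    -- pairs, against independence.
    acyclic : ∀ x xs → ¬ IsCycle EdgeOf x xs
    acyclic x (y ∷ w ∷ ws)
      (_ , (x≢y ∷ x≢w ∷ x≢ws) ∷ y≢ ∷ _ , xy@(i , joins) ∷ yw ∷ linked) =
      x∉p-x ⊤ i (independent (⊤ - i) i (∼⇒Joins π joins (∼-sym π
        (∼-trans π
          -- The edge from `y` to `w` touches `y`, which `arc⇒∼` excludes; it differs from the first
          -- edge because neither of its ends is `x`.
          (avoiding⇒∼ i joins yw λ { (inj₁ (x≡y , _)) → x≢y x≡y ; (inj₂ (x≡w , _)) → x≢w x≡w })
          (arc⇒∼ i joins w ws linked (x≢w ∷ x≢ws) y≢)))))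
      where π = generated e (⊤ - i)
    acyclic x (_ ∷ []) (s≤s () , _)

    loopless : ∀ i → proj₁ (e i) ≢ proj₂ (e i)
    loopless i a≡b = ∉⊥ (independent ⊥ i
      (subst (SameBlock (generated e ⊥) (proj₁ (e i))) a≡b (∼-refl (generated e ⊥))))

  -- Connectedness comes from counting: the cube bound at `⊤` leaves at most `n ∸ m` blocks, and
  -- `n ≤ suc m` makes that at most one.
  independent⇒tree : Fin n → n ≤ suc m → Σ[ T ∈ Tree n ] Enumerates e (Edge T)
  independent⇒tree x n≤1+m = record
    { Edge        = EdgeOf
    ; edge?       = λ u v → Fin.any? λ i →
        ((_ Fin.≟ _) ×-dec (_ Fin.≟ _)) ⊎-dec ((_ Fin.≟ _) ×-dec (_ Fin.≟ _))
    ; symmetric   = EdgeOf-sym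
    ; irreflexive = λ { refl (i , inj₁ (a≡u , b≡u)) → loopless i (trans a≡u (sym b≡u))
                      ; refl (i , inj₂ (a≡u , b≡u)) → loopless i (trans a≡u (sym b≡u)) }
    ; connected   = (x , ∈⊤) , λ {u} {v} _ _ → Star.map (λ uEv → ∈⊤ , ∈⊤ , uEv)
        (generated-least e ⊤ (Star-isEquivalence EdgeOf-sym) (λ {i} _ → sound i ◅ ε)
          (blockCount≤1⇒∼ (generated e ⊤) ≤1 u v))
    ; acyclic     = acyclic
    } , record { symmetric = EdgeOf-sym ; sound = sound ; complete = id }
    where
    sound : ∀ i → EdgeOf (proj₁ (e i)) (proj₂ (e i))
    sound i = i , inj₁ (refl , refl)
    ≤1 : blockCount (generated e ⊤) ≤ 1
    ≤1 = ℕ.+-cancelʳ-≤ m _ _ (begin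
      blockCount (generated e ⊤) + m            ≡⟨ cong (blockCount (generated e ⊤) +_) (sym (∣⊤∣≡n m)) ⟩
      blockCount (generated e ⊤) + ∣ ⊤ {m} ∣    ≤⟨ Embedding.blockCount-upper
                                                     (generated-isOrderEmbedding e independent) ⊤ ⟩
      n                                         ≤⟨ n≤1+m ⟩
      1 + m                                     ∎)
      where open ℕ.≤-Reasoning

-- Block counts along a cube of dimension n - 1 leave no room for a partition strictly between J ⁅ i ⁆
-- and the discrete one, nor for one strictly between J S and the partition generated by its pairs.
module _ {J : Subset m → Partition n} (isEmbedding : IsOrderEmbedding J) (x₀ : Fin n) (n≤1+m : n ≤ suc m) where
  open IsOrderEmbedding isEmbedding
  private
    -- `J ⊥` turns out to be discrete, but that is known only at the end; what `cancel` provides now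
    -- is a pair joined by `J ⁅ i ⁆` and separated by `J ⊥`.
    pair : ∀ i → ∃[ x ] ∃[ y ] x ∼[ J ⁅ i ⁆ ] y × ¬ x ∼[ J ⊥ ] y
    pair i = ≰⇒∃ (J ⊥) (J ⁅ i ⁆) λ J⁅i⁆≤J⊥ → ∉⊥ (cancel J⁅i⁆≤J⊥ (x∈⁅x⁆ i))

    e : Fin m → Fin n × Fin n
    e i = let x , y , _ = pair i in x , y

    e-joined : ∀ i → proj₁ (e i) ∼[ J ⁅ i ⁆ ] proj₂ (e i)
    e-joined i = proj₁ (proj₂ (proj₂ (pair i)))

    J⁅i⁆≤merge : ∀ i → J ⁅ i ⁆ ≤ₚ merge discrete (proj₁ (e i)) (proj₂ (e i))
    J⁅i⁆≤merge i = decidable-stable (≤ₚ? (J ⁅ i ⁆) R) λ J⁅i⁆≰R → ℕ.<-irrefl refl (begin-strict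
      n                                  ≤⟨ n≤1+m ⟩
      suc m                              ≤⟨ Embedding.blockCount-lower isEmbedding x₀ ⁅ i ⁆ ⟩
      blockCount (J ⁅ i ⁆) + ∣ ⁅ i ⁆ ∣   ≡⟨ cong (blockCount (J ⁅ i ⁆) +_) (∣⁅x⁆∣≡1 i) ⟩
      blockCount (J ⁅ i ⁆) + 1           ≡⟨ ℕ.+-comm (blockCount (J ⁅ i ⁆)) 1 ⟩
      suc (blockCount (J ⁅ i ⁆))         ≤⟨ blockCount-strict R (J ⁅ i ⁆) R≤J⁅i⁆ J⁅i⁆≰R ⟩
      blockCount R                       <⟨ blockCount-strict discrete R discrete≤R R≰discrete ⟩
      blockCount (discrete {n})          ≤⟨ blockCount≤n discrete ⟩
      n                                  ∎)
      where
      open ℕ.≤-Reasoning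
      a = proj₁ (e i)
      b = proj₂ (e i)
      R = merge discrete a b
      discrete⇒ : ∀ (π : Partition n) → SameBlock discrete ⇒ SameBlock π
      discrete⇒ π x∼y with refl ← discrete⁻ x∼y = ∼-refl π
      R≤J⁅i⁆ : R ≤ₚ J ⁅ i ⁆
      R≤J⁅i⁆ = ∼⇒≤ {π = R} {J ⁅ i ⁆}
        (merge-least discrete a b (∼-isEquivalence (J ⁅ i ⁆)) (discrete⇒ (J ⁅ i ⁆)) (e-joined i))
      discrete≤R : discrete ≤ₚ R
      discrete≤R = ∼⇒≤ {π = discrete} {R} (discrete⇒ R)
      R≰discrete : ¬ R ≤ₚ discrete
      R≰discrete R≤discrete = proj₂ (proj₂ (proj₂ (pair i)))
        (discrete⇒ (J ⊥) (≤⇒∼ {π = R} {discrete} R≤discrete (merge-joins discrete a b)))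

    generated≤J : ∀ S → generated e S ≤ₚ J S
    generated≤J S = ∼⇒≤ {π = generated e S} {J S} (generated-least e S (∼-isEquivalence (J S)) λ {i} i∈S →
      ≤⇒∼ {π = J ⁅ i ⁆} {J S} (mono (x∈p⇒⁅x⁆⊆p i∈S)) (e-joined i))

    -- If the pairs in `S` connect the ends of pair `i`, then `J S` lies above the partition merging
    -- these ends, hence above `J ⁅ i ⁆`, and `cancel` returns `i ∈ S`.
    e-independent : Independent e
    e-independent S i a∼b = cancel (≤ₚ-trans {π = J ⁅ i ⁆} {R} {J S} (J⁅i⁆≤merge i) R≤JS) (x∈⁅x⁆ i)
      where
      R = merge discrete (proj₁ (e i)) (proj₂ (e i))
      R≤JS : R ≤ₚ J S
      R≤JS = ∼⇒≤ {π = R} {J S} (merge-least discrete _ _ (∼-isEquivalence (J S))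
        (λ x∼y → case discrete⁻ x∼y of λ { refl → ∼-refl (J S) })
        (≤⇒∼ {π = generated e S} {J S} (generated≤J S) a∼b))

    -- Independence makes `generated e` a cube of the same dimension, so its upper bound can be
    -- played against the lower bound of `J`.
    J≈generated : ∀ S → J S ≈ₚ generated e S
    J≈generated S = ≤ₚ-antisym {π = J S} {generated e S}
      (decidable-stable (≤ₚ? (J S) (generated e S)) λ JS≰ →
        ℕ.<⇒≱ (blockCount-strict (generated e S) (J S) (generated≤J S) JS≰)
          (ℕ.+-cancelʳ-≤ ∣ S ∣ _ _ (begin
            blockCount (generated e S) + ∣ S ∣   ≤⟨ Embedding.blockCount-upper
                                                      (generated-isOrderEmbedding e e-independent) S ⟩
            n                                    ≤⟨ n≤1+m ⟩
            suc m                                ≤⟨ Embedding.blockCount-lower isEmbedding x₀ S ⟩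
            blockCount (J S) + ∣ S ∣             ∎)))
      (generated≤J S)
      where open ℕ.≤-Reasoning

  maximal-embedding-generated : Σ[ e ∈ (Fin m → Fin n × Fin n) ] Independent e × Image J ≐ Image (generated e)
  maximal-embedding-generated = e , e-independent ,
    (λ {π} (S , π≈) → S , Setoid.trans (partitionSetoid n) {π} {J S} {generated e S} π≈ (J≈generated S)) ,
    (λ {π} (S , π≈) → S , Setoid.trans (partitionSetoid n) {π} {generated e S} {J S} π≈
      (Setoid.sym (partitionSetoid n) {J S} {generated e S} (J≈generated S)))

-- Largest Boolean sublattices

star : ∀ k → Fin k → Fin (suc k) × Fin (suc k)
star k i = zero , suc i

-- Two-colouring: if `i ∉ S`, the colour that singles out the leaf `suc i` is constant on every pair
-- in `S`, yet it separates the ends of pair `i`.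
star-independent : ∀ k → Independent (star k)
star-independent k S i 0∼i = decidable-stable (i ∈? S) λ i∉S →
  contradiction (trans (0∼i⇒ i∉S) (dec-true (suc i Fin.≟ suc i) refl)) λ ()
  where
  isTip : Fin (suc k) → Bool
  isTip x = does (x Fin.≟ suc i)
  0∼i⇒ : i ∉ S → isTip zero ≡ isTip (suc i)
  0∼i⇒ i∉S = generated-least (star k) S (On.isEquivalence isTip isEquivalence)
    (λ {j} j∈S → sym (dec-false (suc j Fin.≟ suc i) λ { refl → i∉S j∈S })) 0∼i

module _ {L : Pred (Partition n) 0ℓ} (resp : ∀ π σ → π ≈ₚ σ → L π → L σ) {k} (size : HasSize L k) where
  private
    πs = proj₁ size
    πs! = proj₁ (proj₂ size)

    ∈⇔ : ∀ π → L π ⇔ π ∈ₚ πs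
    ∈⇔ = proj₂ (proj₂ (proj₂ size))

    L? : Unary.Decidable L
    L? π = Dec.map (⇔-sym (∈⇔ π)) (Any.any? (≈ₚ? π) πs)

    all-members? : {P : Pred (Partition n) 0ℓ} → (∀ π σ → π ≈ₚ σ → P σ → P π) →
      (∀ π → Dec (P π)) → Dec (∀ π → L π → P π)
    all-members? {P} P-resp P? with All.all? P? πs
    ... | yes all = yes λ π π∈L → go π (find (Equivalence.to (∈⇔ π) π∈L))
      where
      go : ∀ π → ∃[ σ ] (σ ∈ˡ πs × π ≈ₚ σ) → P π
      go π (σ , σ∈ , π≈σ) = P-resp π σ π≈σ (All.lookup all σ∈)
    ... | no ¬all = no λ all → ¬all (All.tabulate λ {π} π∈ →
      all π (Equivalence.from (∈⇔ π) (∈⇒∈ₚ π∈)))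

    IsLeast? : Unary.Decidable (IsLeast L)
    IsLeast? π = L? π ×-dec all-members?
      (λ σ τ σ≈τ π≤τ → ≤ₚ-trans {π = π} {τ} {σ} π≤τ (≈⇒≥ {π = σ} {τ} σ≈τ)) (≤ₚ? π)

    IsAtom? : Unary.Decidable (IsAtom L)
    IsAtom? π = L? π ×-dec (¬? (IsLeast? π) ×-dec all-members? {λ β → β ≤ₚ π → ¬ IsLeast L β → β ≈ₚ π}
      (λ σ τ σ≈τ minimal σ≤π σ-notLeast → Setoid.trans (partitionSetoid n) {σ} {τ} {π} σ≈τ
        (minimal (≤ₚ-trans {π = τ} {σ} {π} (≈⇒≥ {π = σ} {τ} σ≈τ) σ≤π)
          (σ-notLeast ∘ IsLeast-resp resp τ σ (Setoid.sym (partitionSetoid n) {σ} {τ} σ≈τ))))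
      λ β → ≤ₚ? β π →-dec (¬? (IsLeast? β) →-dec ≈ₚ? β π))

  -- `L` is an arbitrary predicate, but its finite listing decides membership, leastness and
  -- minimality by search, so the atoms can be filtered out.
  finite⇒hasDimension : ∃[ d ] HasDimension L d
  finite⇒hasDimension = length αs , αs , SetoidUnique.filter⁺ (partitionSetoid n) IsAtom? πs! , refl ,
    λ π → mk⇔ (λ atom → to π atom (find (Equivalence.to (∈⇔ π) (proj₁ atom)))) (from π ∘ find)
    where
    αs = filter IsAtom? πs
    to : ∀ π → IsAtom L π → ∃[ σ ] (σ ∈ˡ πs × π ≈ₚ σ) → π ∈ₚ αs
    to π atom (σ , σ∈ , π≈σ) = lose {P = π ≈ₚ_} (∈-filter⁺ IsAtom? σ∈ (IsAtom-resp resp π σ π≈σ atom)) π≈σ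
    from : ∀ π → ∃[ σ ] (σ ∈ˡ αs × π ≈ₚ σ) → IsAtom L π
    from π (σ , σ∈ , π≈σ) = IsAtom-resp resp σ π (Setoid.sym (partitionSetoid n) {π} {σ} π≈σ)
      (proj₂ (∈-filter⁻ IsAtom? {xs = πs} σ∈))

HasSize-Image⇒≤2^ : ∀ {L : Pred (Partition n) 0ℓ} {k} (J : Subset m → Partition n) →
  (∀ π → L π → Image J π) → HasSize L k → k ≤ 2 ^ m
HasSize-Image⇒≤2^ {n} {m} {L} J L⊆Image (πs , πs! , refl , ∈⇔) =
  Fin.injective⇒≤ {f = encode ∘ subset} λ {i} {j} → injective i j ∘ encode-injective
  where
  image : ∀ i → Image J (List.lookup πs i)
  image i = L⊆Image _ (Equivalence.from (∈⇔ (List.lookup πs i)) (∈⇒∈ₚ (∈-lookup {xs = πs} i)))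
  subset : Fin (length πs) → Subset m
  subset i = proj₁ (image i)
  injective : ∀ i j → subset i ≡ subset j → i ≡ j
  injective i j eq = lookup-injective (partitionSetoid n) πs! i j
    (≈-via (List.lookup πs i) (List.lookup πs j) (image i) (image j) eq)
    where
    ≈-via : ∀ π σ (p : Image J π) (q : Image J σ) → proj₁ p ≡ proj₁ q → π ≈ₚ σ
    ≈-via π σ (S , π≈) (_ , σ≈) refl = Setoid.trans (partitionSetoid n) {π} {J S} {σ} π≈
      (Setoid.sym (partitionSetoid n) {σ} {J S} σ≈)

-- Only the size `N` is given, so the dimension `d` is extracted from it. Maximality against the
-- star and the cube over the atoms of `L` give `2 ^ k ≤ N ≤ 2 ^ d`, hence `k ≤ d`; the opposite
-- inequality is the block count.
largest⇒hasDimension : ∀ {L : Pred (Partition n) 0ℓ} → Fin n →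
  IsLargestBooleanSublattice L → HasDimension L (n ∸ 1)
largest⇒hasDimension {suc k} {L} x (sublattice , N , size , largest) =
  subst (HasDimension L) (ℕ.≤-antisym d≤k k≤d) (proj₂ dimension)
  where
  open IsBooleanSublattice sublattice
  resp : ∀ π σ → π ≈ₚ σ → L π → L σ
  resp π σ π≈σ = respects {π} {σ} π≈σ
  dimension : ∃[ d ] HasDimension L d
  dimension = finite⇒hasDimension resp size
  d = proj₁ dimension
  cube : ∃[ J ] (IsOrderEmbedding {d} {suc k} J × L ≐ Image J)
  cube = isBooleanSublattice⇒Image sublattice (proj₂ dimension)
  d≤k : d ≤ k
  d≤k = ℕ.≤-pred (Embedding.dimension<n (proj₁ (proj₂ cube)) x)
  2^k≤N : 2 ^ k ≤ N
  2^k≤N = largest (Image (generated (star k))) (2 ^ k)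
    (Image-generated-isBooleanSublattice (star k) (star-independent k))
    (Embedding.Image-hasSize (generated-isOrderEmbedding (star k) (star-independent k)))
  N≤2^d : N ≤ 2 ^ d
  N≤2^d = HasSize-Image⇒≤2^ {L = L} (proj₁ cube) (λ π π∈L → proj₁ (proj₂ (proj₂ cube)) {π} π∈L) size
  k≤d : k ≤ d
  k≤d = ℕ.≮⇒≥ λ d<k → ℕ.<⇒≱ (ℕ.^-monoʳ-< 2 (s≤s (s≤s z≤n)) d<k) (ℕ.≤-trans 2^k≤N N≤2^d)

-- The correspondence with trees

-- Merging only `x` and `y` gives a probe for the edge `xy`: with the converse below, it reads the
-- tree off its lattice, which yields injectivity.
mergedPair-connectedBlocks : ∀ {E : Rel (Fin n) 0ℓ} → Symmetric E → ∀ {x y} → E x y →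
  ConnectedBlocks E (merge discrete x y)
mergedPair-connectedBlocks {E = E} E-sym {x} {y} xEy = All.tabulate λ {B} B∈ →
  All.lookup (nonempty π) B∈ , λ u∈B v∈B → walk u∈B v∈B (merge⁻ discrete x y (B , B∈ , u∈B , v∈B))
  where
  π = merge discrete x y
  walk : ∀ {B u v} → u ∈ B → v ∈ B → Merged discrete x y u v → Star (λ u v → u ∈ B × v ∈ B × E u v) u v
  walk u∈B v∈B (inj₁ u∼v) with refl ← discrete⁻ u∼v = ε
  walk u∈B v∈B (inj₂ (inj₁ (u∼x , y∼v))) with refl ← discrete⁻ u∼x | refl ← discrete⁻ y∼v =
    (u∈B , v∈B , xEy) ◅ ε
  walk u∈B v∈B (inj₂ (inj₂ (u∼y , x∼v))) with refl ← discrete⁻ u∼y | refl ← discrete⁻ x∼v =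
    (u∈B , v∈B , E-sym xEy) ◅ ε

-- A walk from `x` confined to the block of `x` and `y` can only step to `y` at first, a loop being
-- excluded.
connectedBlocks-mergedPair : ∀ {E : Rel (Fin n) 0ℓ} → Irreflexive _≡_ E → ∀ {x y} → x ≢ y →
  ConnectedBlocks E (merge discrete x y) → E x y
connectedBlocks-mergedPair {E = E} E-irrefl {x} {y} x≢y connected
  with B , B∈ , x∈B , y∈B ← merge-joins discrete x y
  with proj₂ (All.lookup connected B∈) x∈B y∈B
... | ε = contradiction refl x≢y
... | _◅_ {j = z} (_ , z∈B , xEz) _ = subst (E x) (z≡y (merge⁻ discrete x y (B , B∈ , x∈B , z∈B))) xEz
  where
  z≡y : Merged discrete x y x z → z ≡ y
  z≡y (inj₁ x∼z) = contradiction xEz (E-irrefl (discrete⁻ x∼z))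
  z≡y (inj₂ (inj₁ (_ , y∼z))) = sym (discrete⁻ y∼z)
  z≡y (inj₂ (inj₂ (x∼y , _))) = contradiction (discrete⁻ x∼y) x≢y

treeLattice-cong : ∀ (T T′ : Tree n) → (∀ {x y} → Edge T x y → Edge T′ x y) →
  ∀ {π} → treeLattice T π → treeLattice T′ π
treeLattice-cong T T′ E⇒E′ = All.map λ (nonempty , connected) →
  nonempty , λ x∈ y∈ → Star.map (λ (u∈ , v∈ , uEv) → u∈ , v∈ , E⇒E′ uEv) (connected x∈ y∈)

treeLattice-reflects : ∀ (T T′ : Tree n) → (∀ {π} → treeLattice T π → treeLattice T′ π) →
  ∀ {x y} → Edge T x y → Edge T′ x y
treeLattice-reflects T T′ L⊆L′ {x} {y} xEy = connectedBlocks-mergedPair (Tree.irreflexive T′)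
  (λ { refl → Tree.irreflexive T refl xEy })
  (L⊆L′ {merge discrete x y} (mergedPair-connectedBlocks (Tree.symmetric T) xEy))

module _ (x₀ : Fin n) where

  -- The members are the generated partitions, for which Boolean structure and atoms are at hand;
  -- `treeSublattice-members` identifies them with `treeLattice T`.
  treeSublattice : Tree n → BooleanSublattice n (n ∸ 1)
  treeSublattice T = record
    { members             = Image (generated (proj₁ (edgeEnumeration T x₀)))
    ; isBooleanSublattice = Image-generated-isBooleanSublattice _ independent
    ; hasDimension        = Embedding.Image-hasDimension (generated-isOrderEmbedding _ independent)
    }
    where independent = proj₁ (proj₂ (edgeEnumeration T x₀))

  treeSublattice-members : ∀ T → members (treeSublattice T) ≐ treeLattice T
  treeSublattice-members T =
    Image-generated≐ConnectedBlocks (proj₂ (proj₂ (edgeEnumeration T x₀)))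

  n≤1+[n∸1] : n ≤ suc (n ∸ 1)
  n≤1+[n∸1] = ℕ.m≤n+m∸n n 1

  embedding⇒tree : ∀ {J : Subset (n ∸ 1) → Partition n} → IsOrderEmbedding J →
    Σ[ T ∈ Tree n ] Image J ≐ treeLattice T
  embedding⇒tree {J} isEmbedding = T , ≐-trans {i = Image J} {Image (generated e)} {treeLattice T}
    (proj₂ (proj₂ family)) (Image-generated≐ConnectedBlocks (proj₂ tree))
    where
    family = maximal-embedding-generated isEmbedding x₀ n≤1+[n∸1]
    e      = proj₁ family
    tree   = independent⇒tree e (proj₁ (proj₂ family)) x₀ n≤1+[n∸1]
    T      = proj₁ tree

  treeSublattice-surjective : ∀ (M : BooleanSublattice n (n ∸ 1)) → Σ[ T ∈ Tree n ] members M ≐ treeLattice T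
  treeSublattice-surjective M = T , ≐-trans {i = members M} {Image J} {treeLattice T}
    (proj₂ (proj₂ cube)) (proj₂ tree)
    where
    cube = isBooleanSublattice⇒Image
      (BooleanSublattice.isBooleanSublattice M) (BooleanSublattice.hasDimension M)
    J    = proj₁ cube
    tree = embedding⇒tree (proj₁ (proj₂ cube))
    T    = proj₁ tree

  treeBijection : Bijection (treeSetoid n) (booleanSublatticeSetoid n (n ∸ 1))
  treeBijection = record
    { to        = treeSublattice
    ; cong      = λ {T} {T′} → to-cong T T′
    ; bijective = (λ {T} {T′} → to-injective T T′) , λ M →
        let T , M≐ = treeSublattice-surjective M in
        T , λ {T′} T′≈T → ≐-trans {i = members (treeSublattice T′)} {members (treeSublattice T)} {members M}
          (to-cong T′ T T′≈T) (≐-trans {i = members (treeSublattice T)} {treeLattice T} {members M}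
            (treeSublattice-members T) (≐-sym {x = members M} {treeLattice T} M≐))
    }
    where
    to-cong : ∀ T T′ → (∀ x y → Edge T x y ⇔ Edge T′ x y) →
      members (treeSublattice T) ≐ members (treeSublattice T′)
    to-cong T T′ T≈T′ =
      ≐-trans {i = members (treeSublattice T)} {treeLattice T} {members (treeSublattice T′)}
        (treeSublattice-members T)
        (≐-trans {i = treeLattice T} {treeLattice T′} {members (treeSublattice T′)}
          ( (λ {π} → treeLattice-cong T T′ (Equivalence.to (T≈T′ _ _)) {π})
          , (λ {π} → treeLattice-cong T′ T (Equivalence.from (T≈T′ _ _)) {π}))
          (≐-sym {x = members (treeSublattice T′)} {treeLattice T′} (treeSublattice-members T′)))

    to-injective : ∀ T T′ → members (treeSublattice T) ≐ members (treeSublattice T′) →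
      ∀ x y → Edge T x y ⇔ Edge T′ x y
    to-injective T T′ eq x y = mk⇔
      (treeLattice-reflects T T′ (λ {π} → proj₁ lattices {π}))
      (treeLattice-reflects T′ T (λ {π} → proj₂ lattices {π}))
      where
      lattices : treeLattice T ≐ treeLattice T′
      lattices = ≐-trans {i = treeLattice T} {members (treeSublattice T)} {treeLattice T′}
        (≐-sym {x = members (treeSublattice T)} {treeLattice T} (treeSublattice-members T))
        (≐-trans {i = members (treeSublattice T)} {members (treeSublattice T′)} {treeLattice T′}
          eq (treeSublattice-members T′))

proposition1p4 : (n : ℕ) → 3 ≤ n →
    (∀ (L : Pred (Partition n) 0ℓ) →
       IsLargestBooleanSublattice L → HasDimension L (n ∸ 1))
    × (Σ[ f ∈ Bijection (treeSetoid n) (booleanSublatticeSetoid n (n ∸ 1)) ]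
         (∀ (T : Tree n) → members (Bijection.to f T) ≐ treeLattice T))
proposition1p4 (suc _) _ =
  (λ L → largest⇒hasDimension {L = L} zero) , treeBijection zero , treeSublattice-members zero
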